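{- Let $q=p^r$ be a prime power, let $t<q-1$, and let $\mathcal{S}$ be a $t$-semiarc of $V_t^\circ$ type in $\mathrm{PG}(2,q)$. Then: (a) if $\gcd(q,t)=1$ and $\gcd(q-1,t-1)=1$, then $\mathcal{S}$ is a $V_t$-configuration; (b) if $\gcd(q,t)=1$, then $\mathcal{S}$ is contained in a vertexless triangle; (c) if $\gcd(q-1,t)=1$, then $\mathcal{S}$ is contained in a vertexless triangle or in the union of three concurrent lines with their common point removed.
   Context: A non-empty point set $\mathcal{S}$ of a projective plane is a $t$-semiarc if for every point $P\in\mathcal{S}$ there are exactly $t$ lines $\ell$ with $\ell\cap\mathcal{S}=\{P\}$ (tangents at $P$). For two distinct lines $\ell_1,\ell_2$, a $V_t$-configuration is a set obtained from the symmetric difference $\ell_1\triangle\ell_2$ by removing $t$ further points from each of $\ell_1\setminus\ell_2$ and $\ell_2\setminus\ell_1$. $\mathcal{S}$ is of $V_t^\circ$ type if there are two distinct lines $\ell_1,\ell_2$ with $\ell_1\cap\ell_2\notin\mathcal{S}$ such that $(\ell_1\triangle\ell_2)\cap\mathcal{S}$ is a $V_t$-configuration with respect to $\ell_1,\ell_2$. A vertexless triangle is the union of three non-concurrent lines with their three pairwise intersection points removed. -}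

module Defs where

open import Data.Nat using (ℕ; zero; suc)
open import Data.Fin using (Fin)
open import Data.Bool using () renaming (_≟_ to _≟B_)
open import Data.Bool using (Bool; true; false; _∧_; _∨_; not; if_then_else_)
open import Data.List using (List; []; _∷_; map; filter; length; concatMap; foldr)
open import Data.Product using (_×_; _,_; Σ; ∃)
open import Data.Sum using (_⊎_; inj₁; inj₂)
open import Data.Unit using (⊤; tt)
open import Relation.Nullary using (¬_; Dec; yes; no; does)
open import Relation.Binary.PropositionalEquality using (_≡_; _≢_; refl)
open import Relation.Binary.Definitions using (DecidableEquality)
open import Algebra.Structures using (IsCommutativeRing)
open import Function.Bundles using (_↔_; Inverse)
open import Data.List using (_++_; allFin)

record FiniteField (q : ℕ) : Set₁ where
  infixl 6 _+_
  infixl 7 _*_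
  field
    Carrier : Set
    _≟_     : DecidableEquality Carrier
    _+_ _*_ : Carrier → Carrier → Carrier
    -_      : Carrier → Carrier
    0# 1#   : Carrier
    isCommutativeRing : IsCommutativeRing _≡_ _+_ _*_ -_ 0# 1#
    0≢1     : 0# ≢ 1#
    _⁻¹     : Carrier → Carrier
    inverseˡ : ∀ x → x ≢ 0# → (x ⁻¹) * x ≡ 1#
    enumeration : Fin q ↔ Carrier

  elements : List Carrier
  elements = map (Inverse.to enumeration) (allFin q)

-- The Desarguesian projective plane PG(2,q) = PG(2, F)
-- Points are given by normalised homogeneous coordinates:
--   (1 : x : y),  (0 : 1 : x),  (0 : 0 : 1).
-- Lines are given the same way by normalised dual coordinates [a : b : c],
-- and the point (x0:x1:x2) lies on [a:b:c] iff a x0 + b x1 + c x2 = 0.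

allB : {A : Set} → (A → Bool) → List A → Bool
allB f = foldr (λ x b → f x ∧ b) true

module PG2 {q : ℕ} (F : FiniteField q) where
  open FiniteField F

  data Point : Set where
    affine : Carrier → Carrier → Point
    infty  : Carrier → Point
    vert   : Point

  Line : Set
  Line = Point   -- dual coordinates, same normalisation

  coords : Point → Carrier × Carrier × Carrier
  coords (affine x y) = 1# , x , y
  coords (infty x)    = 0# , 1# , x
  coords vert         = 0# , 0# , 1#

  dot : Carrier × Carrier × Carrier → Carrier × Carrier × Carrier → Carrier
  dot (a , b , c) (x , y , z) = a * x + b * y + c * z

  on : Point → Line → Bool
  on P ℓ = does (dot (coords P) (coords ℓ) ≟ 0#)

  _≟P_ : Point → Point → Bool
  affine x y ≟P affine x' y' = does (x ≟ x') ∧ does (y ≟ y')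
  infty x ≟P infty x' = does (x ≟ x')
  vert ≟P vert = true
  _ ≟P _ = false

  allPoints : List Point
  allPoints = concatMap (λ x → map (affine x) elements) elements
              ++ (map infty elements ++ (vert ∷ []))

  allLines : List Line
  allLines = allPoints

  count : (Point → Bool) → ℕ
  count f = length (filter (λ P → f P ≟B true) allPoints)

  PointSet : Set
  PointSet = Point → Bool

  _∈S_ : Point → PointSet → Set
  P ∈S S = S P ≡ true

  _⊆_ : PointSet → PointSet → Set
  S ⊆ T = ∀ P → P ∈S S → P ∈S T

  isTangent : PointSet → Point → Line → Bool
  isTangent S P ℓ = S P ∧ on P ℓ ∧
    allB (λ Q → not (S Q ∧ on Q ℓ) ∨ (Q ≟P P)) allPoints

  numTangents : PointSet → Point → ℕ
  numTangents S P = length (filter (λ ℓ → isTangent S P ℓ ≟B true) allLines)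

  IsSemiarc : ℕ → PointSet → Set
  IsSemiarc t S = (∃ λ P → P ∈S S) × (∀ P → P ∈S S → numTangents S P ≡ t)

  symDiff : Line → Line → PointSet
  symDiff ℓ₁ ℓ₂ P = (on P ℓ₁ ∧ not (on P ℓ₂)) ∨ (on P ℓ₂ ∧ not (on P ℓ₁))

  _∩_ : PointSet → PointSet → PointSet
  (S ∩ T) P = S P ∧ T P

  IsVtConfWrt : ℕ → Line → Line → PointSet → Set
  IsVtConfWrt t ℓ₁ ℓ₂ X =
    (ℓ₁ ≢ ℓ₂) × (X ⊆ symDiff ℓ₁ ℓ₂) ×
    (count (λ P → on P ℓ₁ ∧ not (on P ℓ₂) ∧ not (X P)) ≡ t) ×
    (count (λ P → on P ℓ₂ ∧ not (on P ℓ₁) ∧ not (X P)) ≡ t)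

  IsVtConf : ℕ → PointSet → Set
  IsVtConf t X = Σ Line λ ℓ₁ → Σ Line λ ℓ₂ → IsVtConfWrt t ℓ₁ ℓ₂ X

  IsVtCircType : ℕ → PointSet → Set
  IsVtCircType t S = Σ Line λ ℓ₁ → Σ Line λ ℓ₂ →
    (ℓ₁ ≢ ℓ₂) ×
    (∀ P → on P ℓ₁ ≡ true → on P ℓ₂ ≡ true → S P ≡ false) ×
    IsVtConfWrt t ℓ₁ ℓ₂ (symDiff ℓ₁ ℓ₂ ∩ S)

  vertexlessTriangle : Line → Line → Line → PointSet
  vertexlessTriangle ℓ₁ ℓ₂ ℓ₃ P =
    (on P ℓ₁ ∨ on P ℓ₂ ∨ on P ℓ₃) ∧
    not (on P ℓ₁ ∧ on P ℓ₂) ∧ not (on P ℓ₁ ∧ on P ℓ₃) ∧ not (on P ℓ₂ ∧ on P ℓ₃)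

  NonConcurrent : Line → Line → Line → Set
  NonConcurrent ℓ₁ ℓ₂ ℓ₃ = ∀ P → ¬ ((on P ℓ₁ ∧ on P ℓ₂ ∧ on P ℓ₃) ≡ true)

  InVertexlessTriangle : PointSet → Set
  InVertexlessTriangle S = Σ Line λ ℓ₁ → Σ Line λ ℓ₂ → Σ Line λ ℓ₃ →
    NonConcurrent ℓ₁ ℓ₂ ℓ₃ × (S ⊆ vertexlessTriangle ℓ₁ ℓ₂ ℓ₃)

  concurrentTriple : Point → Line → Line → Line → PointSet
  concurrentTriple C ℓ₁ ℓ₂ ℓ₃ P = (on P ℓ₁ ∨ on P ℓ₂ ∨ on P ℓ₃) ∧ not (P ≟P C)

  InConcurrentTriple : PointSet → Set
  InConcurrentTriple S = Σ Point λ C → Σ Line λ ℓ₁ → Σ Line λ ℓ₂ → Σ Line λ ℓ₃ →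
    (ℓ₁ ≢ ℓ₂) × (ℓ₁ ≢ ℓ₃) × (ℓ₂ ≢ ℓ₃) ×
    (on C ℓ₁ ≡ true) × (on C ℓ₂ ≡ true) × (on C ℓ₃ ≡ true) ×
    (S ⊆ concurrentTriple C ℓ₁ ℓ₂ ℓ₃)

{-# OPTIONS --safe #-}
module Submission where

-- Choose coordinates with ℓ₁ the line at infinity and ℓ₂ the line x = 0. Let t₁ be the set of
-- slopes missing from S on ℓ₁ and t₂ the set of intercepts missing from S on ℓ₂; |t₁| = |t₂| = t.
-- A point of S on ℓ₁ has all its tangents through the t missing points of ℓ₂, so for every further
-- point (b , c) of S the projection m ↦ c - m b maps t₁ bijectively onto t₂.
-- * Summing, t c = Σ t₂ + b Σ t₁: if t ≠ 0 in F, all further points lie on one line.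
-- * On a line y = m x + k the projections are k - b (x - m), and the product of y - k over t₂,
--   omitting y = k, is (-b)ⁿ times that of x - m over t₁, omitting x = m. With (-b)^(q-1) = 1 and
--   gcd (q - 1) n = 1 this determines b among the further points of the line.
-- Finally, counting tangents at a further point R, exactly one of the t + 1 lines through R that
-- miss S on ℓ₁ carries another further point.

open import Defs
open import Data.Nat using (ℕ; _<_; _∸_; _^_)
open import Data.Nat.GCD using (gcd)
open import Data.Nat.Primality using (Prime)
open import Data.Product using (_×_)
open import Data.Sum using (_⊎_)
open import Relation.Binary.PropositionalEquality using (_≡_)

open import Data.Nat as ℕ using (zero; suc)
import Data.Nat.Properties as ℕₚ
open import Data.Nat.GCD using (gcd-GCD; module Bézout)
open import Data.Bool using (Bool; true; false; _∧_; _∨_; not) renaming (_≟_ to _≟B_)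
open import Data.Bool.Properties using (¬-not; not-injective)
open import Data.Empty using (⊥; ⊥-elim)
open import Data.List using (List; []; _∷_; _++_; map; filter; length; foldr; allFin
  ; concatMap; cartesianProductWith)
open import Data.List.Properties
  using (length-map; length-tabulate; filter-≐; filter-all; map-id; map-∘; map-cong)
open import Data.List.Membership.Propositional using (_∈_)
open import Data.List.Membership.Propositional.Properties
  using (∈-map⁺; ∈-map⁻; ∈-filter⁺; ∈-filter⁻; ∈-allFin; ∈-++⁺ˡ; ∈-++⁺ʳ; ∈-++⁻
        ; ∈-cartesianProductWith⁺; ∈-cartesianProductWith⁻)
open import Data.List.Membership.Propositional.Properties.WithK using (unique∧set⇒bag)
open import Data.List.Relation.Binary.BagAndSetEquality using (∼bag⇒↭)
open import Data.List.Relation.Binary.Permutation.Propositional using (_↭_; ↭⇒↭ₛ)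
open import Data.List.Relation.Binary.Permutation.Propositional.Properties
  using (↭-length) renaming (map⁺ to ↭-map⁺)
import Data.List.Relation.Binary.Permutation.Setoid.Properties as Permₛ
open import Data.List.Relation.Unary.All as All using ([]; _∷_)
open import Data.List.Relation.Unary.AllPairs using ([]; _∷_)
open import Data.List.Relation.Unary.Any using (here; there)
open import Data.List.Relation.Unary.Unique.Propositional using (Unique)
open import Data.List.Relation.Unary.Unique.Propositional.Properties
  using (map⁺; filter⁺; ++⁺; allFin⁺; cartesianProductWith⁺)
open import Data.Maybe as Maybe using (Maybe; just; nothing)
open import Data.Product using (_,_; ∃; proj₁; proj₂)
open import Data.Sum using (inj₁; inj₂)
open import Data.Unit using (⊤; tt)
open import Function using (_∘_; case_of_; id)
open import Function.Bundles using (Inverse; mk⇔)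
open import Level using (0ℓ)
open import Relation.Nullary using (¬_; Dec; yes; no; does; contradiction)
open import Relation.Nullary.Decidable using (dec-true; dec-false; dec⇒maybe)
open import Relation.Binary.Definitions using (DecidableEquality)
import Relation.Binary.PropositionalEquality as ≡
open import Algebra.Bundles using (CommutativeMonoid; CommutativeRing; RawRing)
open import Algebra.Structures using (IsCommutativeMonoid)
import Algebra.Properties.CommutativeMonoid.Mult as CommutativeMonoidMult
import Algebra.Properties.Semiring.Mult as SemiringMult
import Algebra.Solver.Ring
open import Algebra.Solver.Ring.AlmostCommutativeRing using (_-Raw-AlmostCommutative⟶_; fromCommutativeRing)

-- The exponent n explains both conditions on q - 1. When t ≠ 0 in F, the line containing all
-- further points must be the secant that the count at R provides. That secant misses S on ℓ₁, so
-- its slope m lies in t₁; omitting m leaves n = t - 1. The secant carries a second further point,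
-- so uniqueness of b is contradicted and no further point exists. Without the condition on t - 1
-- there still is a triangle, because m in t₁ and the image of m in t₂ say that the third line meets
-- ℓ₁ and ℓ₂ outside S. When gcd (q - 1, t) = 1, two further points on a line with slope m outside
-- t₁ would give n = t, hence coincide. So every line joining two further points misses S on ℓ₁, and
-- through a fixed R it can only be the unique secant: again all further points share a line.
-- Nothing now prevents that line from being vertical, that is, from passing through ℓ₁ ∩ ℓ₂; this
-- is where three concurrent lines come from.

-- A ring solver with integer coefficients.

module RingSolver (R : CommutativeRing 0ℓ 0ℓ) where
  open CommutativeRing R
  open import Algebra.Properties.Semiring.Mult semiring
    using (×-homo-1; ×-homo-+; ×1-homo-*) renaming (_×_ to _·_)
  open import Algebra.Properties.Ring ring
  open import Algebra.Properties.CommutativeSemigroup +-commutativeSemigroup using (interchange)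
  open import Relation.Binary.Reasoning.Setoid setoid

  private
    -- (a , b) stands for the integer a - b: the solver cancels terms by comparing coefficients,
    -- which the abstract ring R itself cannot decide by computation.
    differences : RawRing 0ℓ 0ℓ
    differences = record
      { Carrier = ℕ × ℕ
      ; _≈_ = _≡_
      ; _+_ = λ (a , b) (c , d) → a ℕ.+ c , b ℕ.+ d
      ; _*_ = λ (a , b) (c , d) → a ℕ.* c ℕ.+ b ℕ.* d , a ℕ.* d ℕ.+ b ℕ.* c
      ; -_  = λ (a , b) → b , a
      ; 0#  = 0 , 0
      ; 1#  = 1 , 0
      }

    infix 8 ⟨_⟩
    ⟨_⟩ : ℕ → Carrier
    ⟨ n ⟩ = n · 1#

    ⟦_⟧ : ℕ × ℕ → Carrier
    ⟦ a , b ⟧ = ⟨ a ⟩ - ⟨ b ⟩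

    +-homo : ∀ a b c d → ⟦ a ℕ.+ c , b ℕ.+ d ⟧ ≈ ⟦ a , b ⟧ + ⟦ c , d ⟧
    +-homo a b c d = begin
      ⟨ a ℕ.+ c ⟩ - ⟨ b ℕ.+ d ⟩           ≈⟨ +-cong (×-homo-+ 1# a c) (-‿cong (×-homo-+ 1# b d)) ⟩
      (⟨ a ⟩ + ⟨ c ⟩) - (⟨ b ⟩ + ⟨ d ⟩)   ≈⟨ +-congˡ (-‿+-comm _ _) ⟨
      (⟨ a ⟩ + ⟨ c ⟩) + (- ⟨ b ⟩ - ⟨ d ⟩) ≈⟨ interchange _ _ _ _ ⟩
      (⟨ a ⟩ - ⟨ b ⟩) + (⟨ c ⟩ - ⟨ d ⟩)   ∎

    neg-homo : ∀ a b → ⟦ b , a ⟧ ≈ - ⟦ a , b ⟧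
    neg-homo a b = sym (⁻¹-anti-homo‿- ⟨ a ⟩ ⟨ b ⟩)

    *-homo : ∀ a b c d →
      ⟦ a ℕ.* c ℕ.+ b ℕ.* d , a ℕ.* d ℕ.+ b ℕ.* c ⟧ ≈ ⟦ a , b ⟧ * ⟦ c , d ⟧
    *-homo a b c d = begin
      ⟦ a ℕ.* c ℕ.+ b ℕ.* d , a ℕ.* d ℕ.+ b ℕ.* c ⟧
        -- Reordering makes the pair split as (ac , bc) + (bd , ad), which is (a - b)c - (a - b)d.
        ≡⟨ ≡.cong (λ z → ⟦ a ℕ.* c ℕ.+ b ℕ.* d , z ⟧) (ℕₚ.+-comm (a ℕ.* d) _) ⟩
      ⟦ a ℕ.* c ℕ.+ b ℕ.* d , b ℕ.* c ℕ.+ a ℕ.* d ⟧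
        ≈⟨ +-homo (a ℕ.* c) (b ℕ.* c) (b ℕ.* d) (a ℕ.* d) ⟩
      ⟦ a ℕ.* c , b ℕ.* c ⟧ + ⟦ b ℕ.* d , a ℕ.* d ⟧
        ≈⟨ +-cong (scale a b c) (trans (neg-homo (a ℕ.* d) (b ℕ.* d)) (-‿cong (scale a b d))) ⟩
      (⟨ a ⟩ - ⟨ b ⟩) * ⟨ c ⟩ - (⟨ a ⟩ - ⟨ b ⟩) * ⟨ d ⟩
        ≈⟨ x[y-z]≈xy-xz _ _ _ ⟨
      (⟨ a ⟩ - ⟨ b ⟩) * (⟨ c ⟩ - ⟨ d ⟩)  ∎
      where
      scale : ∀ a b c → ⟦ a ℕ.* c , b ℕ.* c ⟧ ≈ (⟨ a ⟩ - ⟨ b ⟩) * ⟨ c ⟩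
      scale a b c = begin
        ⟨ a ℕ.* c ⟩ - ⟨ b ℕ.* c ⟩         ≈⟨ +-cong (×1-homo-* a c) (-‿cong (×1-homo-* b c)) ⟩
        ⟨ a ⟩ * ⟨ c ⟩ - ⟨ b ⟩ * ⟨ c ⟩     ≈⟨ [y-z]x≈yx-zx _ _ _ ⟨
        (⟨ a ⟩ - ⟨ b ⟩) * ⟨ c ⟩           ∎

    morphism : differences -Raw-AlmostCommutative⟶ fromCommutativeRing R
    morphism = record
      { ⟦_⟧    = ⟦_⟧
      ; +-homo = λ (a , b) (c , d) → +-homo a b c d
      ; *-homo = λ (a , b) (c , d) → *-homo a b c d
      ; -‿homo = λ (a , b) → neg-homo a b
      ; 0-homo = -‿inverseʳ 0#
      ; 1-homo = trans (+-congʳ (×-homo-1 1#)) (trans (+-congˡ -0#≈0#) (+-identityʳ 1#))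
      }

    -- Differences are compared by cross addition in ℕ. In positive characteristic this test is only
    -- sufficient, and `nothing` claims no inequality.
    coeff≟ : ∀ x y → Maybe.Maybe (⟦ x ⟧ ≈ ⟦ y ⟧)
    coeff≟ (a , b) (c , d) = Maybe.map
      (λ eq → x∙y⁻¹≈ε⇒x≈y _ _ (begin
        ⟦ a , b ⟧ - ⟦ c , d ⟧         ≈⟨ +-congˡ (neg-homo c d) ⟨
        ⟦ a , b ⟧ + ⟦ d , c ⟧         ≈⟨ +-homo a b d c ⟨
        ⟦ a ℕ.+ d , b ℕ.+ c ⟧         ≈⟨ x≈y⇒x∙y⁻¹≈ε (reflexive (≡.cong ⟨_⟩ eq)) ⟩
        0# ∎))
      (dec⇒maybe (a ℕ.+ d ℕ.≟ b ℕ.+ c))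

  open Algebra.Solver.Ring differences (fromCommutativeRing R) morphism coeff≟ public

open ≡ using (_≢_; refl; sym; trans; cong; cong₂; subst; setoid; module ≡-Reasoning)

-- Counting in finite sets.

record Listing (A : Set) : Set where
  field
    list     : List A
    unique   : Unique list
    complete : ∀ a → a ∈ list

open Listing

private
  variable
    A B : Set

select : (A → Bool) → List A → List A
select p = filter (λ x → p x ≟B true)

-- At `point-listing` this unfolds to `count` and `numTangents`, so the counting lemmas apply to
-- them without conversion.
#_of_ : (A → Bool) → Listing A → ℕ
# p of as = length (select p (list as))

infix 5 #_of_

select-Unique : ∀ (as : Listing A) p → Unique (select p (list as))
select-Unique as p = filter⁺ _ (unique as)

∈-select⁺ : ∀ (as : Listing A) p {a} → p a ≡ true → a ∈ select p (list as)
∈-select⁺ as p {a} pa = ∈-filter⁺ (λ x → p x ≟B true) (complete as a) pa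

∈-select⁻ : ∀ (as : Listing A) p {a} → a ∈ select p (list as) → p a ≡ true
∈-select⁻ as p a∈ = proj₂ (∈-filter⁻ (λ x → p x ≟B true) {xs = list as} a∈)

unique∧set⇒↭ : {xs ys : List A} → Unique xs → Unique ys →
  (∀ {a} → a ∈ xs → a ∈ ys) → (∀ {a} → a ∈ ys → a ∈ xs) → xs ↭ ys
unique∧set⇒↭ ux uy to from = ∼bag⇒↭ (unique∧set⇒bag ux uy (mk⇔ to from))

-- A permutation rather than an equality of lengths, because sums and products over the two sets are
-- to be compared as well as sizes.
select-image-↭ : (as : Listing A) (bs : Listing B) (f : A → B) →
  (∀ {x y} → f x ≡ f y → x ≡ y) → (p : A → Bool) (q : B → Bool) →
  (∀ a → p a ≡ q (f a)) → (∀ b → q b ≡ true → ∃ λ a → b ≡ f a) →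
  map f (select p (list as)) ↭ select q (list bs)
select-image-↭ as bs f f-inj p q p≡qf onto = unique∧set⇒↭
  (map⁺ f-inj (select-Unique as p)) (select-Unique bs q)
  (λ b∈ → case ∈-map⁻ f b∈ of λ where
    (a , a∈ , refl) → ∈-select⁺ bs q (trans (sym (p≡qf a)) (∈-select⁻ as p a∈)))
  (λ {b} b∈ → case onto b (∈-select⁻ bs q b∈) of λ where
    (a , refl) → ∈-map⁺ f (∈-select⁺ as p (trans (p≡qf a) (∈-select⁻ bs q b∈))))

count-image : (as : Listing A) (bs : Listing B) (f : A → B) →
  (∀ {x y} → f x ≡ f y → x ≡ y) → (p : A → Bool) (q : B → Bool) →
  (∀ a → p a ≡ q (f a)) → (∀ b → q b ≡ true → ∃ λ a → b ≡ f a) →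
  # p of as ≡ # q of bs
count-image as bs f f-inj p q p≡qf onto = trans
  (sym (length-map f (select p (list as))))
  (↭-length (select-image-↭ as bs f f-inj p q p≡qf onto))

∧-≡true : ∀ {b c} → b ∧ c ≡ true → b ≡ true × c ≡ true
∧-≡true {true} c≡true = refl , c≡true

count-cong : (as : Listing A) {p q : A → Bool} → (∀ a → p a ≡ q a) → # p of as ≡ # q of as
count-cong as p≡q = cong length
  (filter-≐ _ _ ((λ {a} pa → trans (sym (p≡q a)) pa) , (λ {a} qa → trans (p≡q a) qa)) (list as))

count-split : (as : Listing A) (p q : A → Bool) →
  # p of as ≡ (# (λ a → p a ∧ q a) of as) ℕ.+ (# (λ a → p a ∧ not (q a)) of as)
count-split as p q = go (list as)
  where
  go : ∀ xs → length (select p xs) ≡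
    length (select (λ a → p a ∧ q a) xs) ℕ.+ length (select (λ a → p a ∧ not (q a)) xs)
  go [] = refl
  go (x ∷ xs) with p x | q x
  ... | false | _     = go xs
  ... | true  | true  = cong suc (go xs)
  ... | true  | false = trans (cong suc (go xs)) (sym (ℕₚ.+-suc _ _))

count-difference : (as : Listing A) (p q : A → Bool) → (∀ a → q a ≡ true → p a ≡ true) →
  # p of as ≡ (# q of as) ℕ.+ (# (λ a → p a ∧ not (q a)) of as)
count-difference as p q q⇒p = trans (count-split as p q)
  (cong (ℕ._+ (# (λ a → p a ∧ not (q a)) of as)) (count-cong as p∧q≡q))
  where
  p∧q≡q : ∀ a → p a ∧ q a ≡ q a
  p∧q≡q a with p a in pa | q a in qa
  ... | true  | _     = refl
  ... | false | false = refl
  ... | false | true  = contradiction (trans (sym pa) (q⇒p a qa)) (λ ())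

-- The complement of `q` in `p` has size 0. This is how the number of tangents determines which
-- lines are tangent.
⇒∧count≡⇒≗ : (as : Listing A) (p q : A → Bool) → (∀ a → q a ≡ true → p a ≡ true) →
  # p of as ≡ # q of as → ∀ a → p a ≡ q a
⇒∧count≡⇒≗ as p q q⇒p eq a with p a in pa | q a in qa
... | true  | true  = refl
... | false | false = refl
... | false | true  = contradiction (trans (sym pa) (q⇒p a qa)) (λ ())
... | true  | false = ⊥-elim (go (select d (list as)) d∈ d-empty)
  where
  d = λ a → p a ∧ not (q a)
  d∈ : a ∈ select d (list as)
  d∈ = ∈-select⁺ as d (cong₂ (λ b c → b ∧ not c) pa qa)
  d-empty : # d of as ≡ 0
  d-empty = ℕₚ.+-cancelˡ-≡ (# q of as) _ _
    (trans (sym (count-difference as p q q⇒p)) (trans eq (sym (ℕₚ.+-identityʳ _))))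
  go : ∀ xs → a ∈ xs → ¬ (length xs ≡ 0)
  go (_ ∷ _) _ ()

-- The complement of `q` in `p` has size 1. Intended for `t + 1` candidate lines of which `t` are
-- tangents.
count-suc-difference : (as : Listing A) (p q : A → Bool) → (∀ a → q a ≡ true → p a ≡ true) →
  # p of as ≡ suc (# q of as) →
  ∃ λ a → p a ≡ true × q a ≡ false × (∀ a' → p a' ≡ true → q a' ≡ false → a' ≡ a)
count-suc-difference {A = A} as p q q⇒p eq with select d (list as) in sel | d-single
  where
  d = λ a → p a ∧ not (q a)
  d-single : # d of as ≡ 1
  d-single = ℕₚ.+-cancelˡ-≡ (# q of as) _ _
    (trans (sym (count-difference as p q q⇒p)) (trans eq (sym (ℕₚ.+-comm _ 1))))
... | a ∷ [] | refl = a , proj₁ da , not-injective (proj₂ da) , λ a' pa' qa' →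
  case subst (a' ∈_) sel (∈-select⁺ as _ (cong₂ (λ b c → b ∧ not c) pa' qa')) of λ where
    (here a'≡a) → a'≡a
  where
  da : p a ≡ true × not (q a) ≡ true
  da = ∧-≡true (∈-select⁻ as (λ a → p a ∧ not (q a)) (subst (a ∈_) (sym sel) (here refl)))

count-remove : (_≟_ : DecidableEquality A) (as : Listing A) (p : A → Bool) (a : A) → p a ≡ true →
  # p of as ≡ suc (# (λ x → p x ∧ not (does (x ≟ a))) of as)
count-remove _≟_ as p a pa = ↭-length (unique∧set⇒↭
  (select-Unique as p)
  (All.tabulate (λ x∈ a≡x → a∉ (subst (_∈ _) (sym a≡x) x∈)) ∷ select-Unique as p')
  (λ {x} x∈ → split x (∈-select⁻ as p x∈))
  (λ { (here refl) → ∈-select⁺ as p pa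
     ; (there x∈) → ∈-select⁺ as p (proj₁ (∧-≡true (∈-select⁻ as p' x∈))) }))
  where
  p' = λ x → p x ∧ not (does (x ≟ a))
  a∉ : ¬ (a ∈ select p' (list as))
  a∉ a∈ with a ≟ a | ∧-≡true {p a} (∈-select⁻ as p' a∈)
  ... | yes _ | _ , ()
  ... | no a≢a | _ = a≢a refl
  split : ∀ x → p x ≡ true → x ∈ a ∷ select p' (list as)
  split x px with x ≟ a in eq
  ... | yes refl = here refl
  ... | no _ = there (∈-select⁺ as p' (cong₂ (λ b c → b ∧ not (does c)) px eq))

count≢0⇒∃ : (as : Listing A) (p : A → Bool) → # p of as ≢ 0 → ∃ λ a → p a ≡ true
count≢0⇒∃ as p p≢0 with select p (list as) in sel
... | []    = contradiction refl p≢0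
... | a ∷ _ = a , ∈-select⁻ as p (subst (a ∈_) (sym sel) (here refl))

-- Folds and orders in commutative monoids.

module Fold {M : Set} {_∙_ : M → M → M} {ε : M} (isCM : IsCommutativeMonoid _≡_ _∙_ ε) where

  commutativeMonoid : CommutativeMonoid _ _
  commutativeMonoid = record { isCommutativeMonoid = isCM }

  open CommutativeMonoid commutativeMonoid using (comm; assoc; identityˡ; identityʳ)
  open CommutativeMonoidMult commutativeMonoid public
    using (×-homo-+; ×-assocˡ; ×-distrib-+) renaming (_×_ to _·_)

  fold : List M → M
  fold = foldr _∙_ ε

  fold-↭ : ∀ {xs ys} → xs ↭ ys → fold xs ≡ fold ys
  fold-↭ xs↭ys = Permₛ.foldr-commMonoid (setoid M) isCM (↭⇒↭ₛ xs↭ys)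

  fold-map-∙ : (f : A → M) (g : A → M) (xs : List A) →
    fold (map (λ x → f x ∙ g x) xs) ≡ fold (map f xs) ∙ fold (map g xs)
  fold-map-∙ f g [] = sym (identityˡ ε)
  fold-map-∙ f g (x ∷ xs) = begin
    (f x ∙ g x) ∙ fold (map (λ x → f x ∙ g x) xs) ≡⟨ cong ((f x ∙ g x) ∙_) (fold-map-∙ f g xs) ⟩
    (f x ∙ g x) ∙ (F ∙ G)  ≡⟨ assoc _ _ _ ⟩
    f x ∙ (g x ∙ (F ∙ G))  ≡⟨ cong (f x ∙_) (sym (assoc _ _ _)) ⟩
    f x ∙ ((g x ∙ F) ∙ G)  ≡⟨ cong (λ z → f x ∙ (z ∙ G)) (comm _ _) ⟩
    f x ∙ ((F ∙ g x) ∙ G)  ≡⟨ cong (f x ∙_) (assoc _ _ _) ⟩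
    f x ∙ (F ∙ (g x ∙ G))  ≡⟨ assoc _ _ _ ⟨
    (f x ∙ F) ∙ (g x ∙ G)  ∎
    where
    open ≡-Reasoning
    F = fold (map f xs)
    G = fold (map g xs)

  fold-const : (a : M) (xs : List A) → fold (map (λ _ → a) xs) ≡ length xs · a
  fold-const a [] = refl
  fold-const a (x ∷ xs) = cong (a ∙_) (fold-const a xs)

  ·-ε : ∀ n → n · ε ≡ ε
  ·-ε zero = refl
  ·-ε (suc n) = trans (identityˡ _) (·-ε n)

  multiple-order : ∀ x {m a} → m · a ≡ ε → (x ℕ.* m) · a ≡ ε
  multiple-order x {m} {a} ma≡ε = trans (sym (×-assocˡ a x m)) (trans (cong (x ·_) ma≡ε) (·-ε x))

  -- Bézout's identity over ℕ writes the gcd plus a multiple of one exponent as a multiple of the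
  -- other, so no inverses are needed. The lemma thus serves both addition and multiplication in the
  -- field, 0 included.
  coprime-order : ∀ m n a → gcd m n ≡ 1 → m · a ≡ ε → n · a ≡ ε → a ≡ ε
  coprime-order m n a gcd≡1 ma≡ε na≡ε = from-bézout (Bézout.identity (gcd-GCD m n))
    where
    cancel : ∀ {k l} → k · a ≡ ε → l · a ≡ ε → gcd m n ℕ.+ l ≡ k → a ≡ ε
    cancel {k} {l} ka≡ε la≡ε eq = begin
      a                        ≡⟨ identityʳ a ⟨
      1 · a                    ≡⟨ identityʳ _ ⟨
      (1 · a) ∙ ε              ≡⟨ cong₂ (λ d z → (d · a) ∙ z) (sym gcd≡1) (sym la≡ε) ⟩
      (gcd m n · a) ∙ (l · a)  ≡⟨ ×-homo-+ a (gcd m n) l ⟨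
      (gcd m n ℕ.+ l) · a      ≡⟨ cong (_· a) eq ⟩
      k · a                    ≡⟨ ka≡ε ⟩
      ε                        ∎
      where open ≡-Reasoning
    from-bézout : Bézout.Identity (gcd m n) m n → a ≡ ε
    from-bézout (Bézout.+- x y eq) =
      cancel (multiple-order x {m} ma≡ε) (multiple-order y {n} na≡ε) eq
    from-bézout (Bézout.-+ x y eq) =
      cancel (multiple-order y {n} na≡ε) (multiple-order x {m} ma≡ε) eq

-- Field arithmetic.

module FieldTheory {q : ℕ} (F : FiniteField q) where
  open FiniteField F

  commutativeRing : CommutativeRing 0ℓ 0ℓ
  commutativeRing = record { isCommutativeRing = isCommutativeRing }

  open CommutativeRing commutativeRing using
    (+-identityˡ; *-assoc; *-comm; *-identityˡ; zeroˡ; zeroʳ; -‿inverseʳ)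
  open RingSolver commutativeRing using (solve; _:=_; _:+_; _:*_; :-_)

  *-cancelˡ-0 : ∀ {x y} → x ≢ 0# → x * y ≡ 0# → y ≡ 0#
  *-cancelˡ-0 {x} {y} x≢0 xy≡0 = begin
    y                ≡⟨ *-identityˡ y ⟨
    1# * y           ≡⟨ cong (_* y) (inverseˡ x x≢0) ⟨
    x ⁻¹ * x * y     ≡⟨ *-assoc _ _ _ ⟩
    x ⁻¹ * (x * y)   ≡⟨ cong (x ⁻¹ *_) xy≡0 ⟩
    x ⁻¹ * 0#        ≡⟨ zeroʳ _ ⟩
    0#               ∎
    where open ≡-Reasoning

  *-≢0 : ∀ {x y} → x ≢ 0# → y ≢ 0# → x * y ≢ 0#
  *-≢0 x≢0 y≢0 xy≡0 = y≢0 (*-cancelˡ-0 x≢0 xy≡0)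

  inverseʳ : ∀ x → x ≢ 0# → x * x ⁻¹ ≡ 1#
  inverseʳ x x≢0 = trans (*-comm _ _) (inverseˡ x x≢0)

  ⁻¹-≢0 : ∀ {x} → x ≢ 0# → x ⁻¹ ≢ 0#
  ⁻¹-≢0 {x} x≢0 x⁻¹≡0 = 0≢1 (begin
    0#        ≡⟨ zeroˡ x ⟨
    0# * x    ≡⟨ cong (_* x) x⁻¹≡0 ⟨
    x ⁻¹ * x  ≡⟨ inverseˡ x x≢0 ⟩
    1#        ∎)
    where open ≡-Reasoning

  x*[x⁻¹*y]≡y : ∀ {x} y → x ≢ 0# → x * (x ⁻¹ * y) ≡ y
  x*[x⁻¹*y]≡y {x} y x≢0 =
    trans (sym (*-assoc _ _ _)) (trans (cong (_* y) (inverseʳ x x≢0)) (*-identityˡ y))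

  x-y≡0⇒x≡y : ∀ x y → x + - y ≡ 0# → x ≡ y
  x-y≡0⇒x≡y x y eq = begin
    x             ≡⟨ solve 2 (λ x y → x := (x :+ :- y) :+ y) refl x y ⟩
    (x + - y) + y ≡⟨ cong (_+ y) eq ⟩
    0# + y        ≡⟨ +-identityˡ y ⟩
    y             ∎
    where open ≡-Reasoning

  x≡y⇒x-y≡0 : ∀ {x y} → x ≡ y → x + - y ≡ 0#
  x≡y⇒x-y≡0 {x} refl = -‿inverseʳ x

  *-cancelˡ : ∀ {a} x y → a ≢ 0# → a * x ≡ a * y → x ≡ y
  *-cancelˡ {a} x y a≢0 eq = x-y≡0⇒x≡y x y (*-cancelˡ-0 a≢0
    (trans (solve 3 (λ a x y → a :* (x :+ :- y) := a :* x :+ :- (a :* y)) refl a x y) (x≡y⇒x-y≡0 eq)))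

  field-listing : Listing Carrier
  field-listing = record
    { list     = elements
    ; unique   = map⁺ to-injective (allFin⁺ q)
    ; complete = λ x → subst (_∈ elements) (Inverse.strictlyInverseˡ enumeration x)
                   (∈-map⁺ (Inverse.to enumeration) (∈-allFin (Inverse.from enumeration x)))
    }
    where
    to-injective : ∀ {i j} → Inverse.to enumeration i ≡ Inverse.to enumeration j → i ≡ j
    to-injective {i} {j} eq = trans (sym (Inverse.strictlyInverseʳ enumeration i))
      (trans (cong (Inverse.from enumeration) eq) (Inverse.strictlyInverseʳ enumeration j))

-- Points, vectors and projectivities.

module Plane {q : ℕ} (F : FiniteField q) where
  open FiniteField F
  open PG2 F
  open FieldTheory F
  open CommutativeRing commutativeRing using
    (+-identityˡ; +-identityʳ; *-assoc; *-comm; *-identityˡ; *-identityʳ; zeroˡ; zeroʳ)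
  open RingSolver commutativeRing using (solve; _:=_; _:+_; _:*_)

  affine-injective : ∀ {x y x' y'} → affine x y ≡ affine x' y' → x ≡ x' × y ≡ y'
  affine-injective refl = refl , refl

  infty-injective : ∀ {x x'} → infty x ≡ infty x' → x ≡ x'
  infty-injective refl = refl

  point-listing : Listing Point
  point-listing = record { list = allPoints ; unique = uniq ; complete = compl }
    where
    affines≡ : ∀ xs ys → concatMap (λ x → map (affine x) ys) xs ≡ cartesianProductWith affine xs ys
    affines≡ [] ys = refl
    affines≡ (x ∷ xs) ys = cong (map (affine x) ys ++_) (affines≡ xs ys)

    affines = concatMap (λ x → map (affine x) elements) elements

    ∈-affines⁻ : ∀ {P} → P ∈ affines → ∃ λ x → ∃ λ y → P ≡ affine x y
    ∈-affines⁻ {P} P∈ with ∈-cartesianProductWith⁻ affine elements elements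
                             (subst (P ∈_) (affines≡ elements elements) P∈)
    ... | x , y , _ , _ , P≡ = x , y , P≡

    uniq : Unique allPoints
    uniq = ++⁺
      (subst Unique (sym (affines≡ elements elements))
        (cartesianProductWith⁺ affine affine-injective (unique field-listing) (unique field-listing)))
      (++⁺ (map⁺ infty-injective (unique field-listing)) ([] ∷ [])
        λ { (v∈ , here refl) → case ∈-map⁻ infty v∈ of λ { (_ , _ , ()) } })
      λ (P∈ , P∈′) → case ∈-affines⁻ P∈ , ∈-++⁻ (map infty elements) P∈′ of λ where
        ((_ , _ , refl) , inj₁ P∈″) → case ∈-map⁻ infty P∈″ of λ { (_ , _ , ()) }
        ((_ , _ , refl) , inj₂ (here ()))

    compl : ∀ P → P ∈ allPoints
    compl (affine x y) = ∈-++⁺ˡ (subst (affine x y ∈_) (sym (affines≡ elements elements))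
      (∈-cartesianProductWith⁺ affine (complete field-listing x) (complete field-listing y)))
    compl (infty x) = ∈-++⁺ʳ affines (∈-++⁺ˡ (∈-map⁺ infty (complete field-listing x)))
    compl vert = ∈-++⁺ʳ affines (∈-++⁺ʳ (map infty elements) (here refl))

  V : Set
  V = Carrier × Carrier × Carrier

  𝟎 : V
  𝟎 = 0# , 0# , 0#

  infixr 7 _⊙_
  infixl 7 _⊗_

  _⊙_ : Carrier → V → V
  k ⊙ (x , y , z) = k * x , k * y , k * z

  _⊗_ : V → V → V
  (a , b , c) ⊗ (x , y , z) = b * z + - (c * y) , c * x + - (a * z) , a * y + - (b * x)

  ≡-vec : ∀ {x y z x' y' z' : Carrier} → x ≡ x' → y ≡ y' → z ≡ z' → (x , y , z) ≡ (x' , y' , z')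
  ≡-vec refl refl refl = refl

  ⊙-assoc : ∀ k l v → k ⊙ l ⊙ v ≡ (k * l) ⊙ v
  ⊙-assoc k l (x , y , z) =
    ≡-vec (sym (*-assoc k l x)) (sym (*-assoc k l y)) (sym (*-assoc k l z))

  1⊙ : ∀ v → 1# ⊙ v ≡ v
  1⊙ (x , y , z) = ≡-vec (*-identityˡ x) (*-identityˡ y) (*-identityˡ z)

  dot-⊙ : ∀ k l v w → dot (k ⊙ v) (l ⊙ w) ≡ (k * l) * dot v w
  dot-⊙ k l (a , b , c) (x , y , z) = solve 8 (λ k l a b c x y z →
    (k :* a) :* (l :* x) :+ (k :* b) :* (l :* y) :+ (k :* c) :* (l :* z) :=
    (k :* l) :* (a :* x :+ b :* y :+ c :* z)) refl k l a b c x y z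

  coords≢𝟎 : ∀ P → coords P ≢ 𝟎
  coords≢𝟎 (affine x y) eq = 0≢1 (sym (cong proj₁ eq))
  coords≢𝟎 (infty x) eq = 0≢1 (sym (cong (proj₁ ∘ proj₂) eq))
  coords≢𝟎 vert eq = 0≢1 (sym (cong (proj₂ ∘ proj₂) eq))

  -- If the leading 1s stand in the same position, they force `k` to be 1; if not, 0 and 1 get
  -- identified. A zero `k` is excluded by the leading 1 of `P`.
  coords-proportional : ∀ P Q k → coords P ≡ k ⊙ coords Q → P ≡ Q
  coords-proportional P Q k eq = go P Q (cong proj₁ eq) (cong (proj₁ ∘ proj₂) eq) (cong (proj₂ ∘ proj₂) eq)
    where
    scale : ∀ {x y} → 1# ≡ k * 1# → x ≡ k * y → x ≡ y
    scale {x} {y} 1≡k x≡ky =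
      trans x≡ky (trans (cong (_* y) (trans (sym (*-identityʳ k)) (sym 1≡k))) (*-identityˡ y))
    1≢k0 : 1# ≢ k * 0#
    1≢k0 eq = 0≢1 (sym (trans eq (zeroʳ k)))
    k≢0 : ∀ {x} → 0# ≡ k * 1# → 1# ≢ k * x
    k≢0 {x} 0≡k 1≡kx = 0≢1 (sym (trans 1≡kx
      (trans (cong (_* x) (trans (sym (*-identityʳ k)) (sym 0≡k))) (zeroˡ x))))
    go : ∀ P Q → proj₁ (coords P) ≡ k * proj₁ (coords Q) →
      proj₁ (proj₂ (coords P)) ≡ k * proj₁ (proj₂ (coords Q)) →
      proj₂ (proj₂ (coords P)) ≡ k * proj₂ (proj₂ (coords Q)) → P ≡ Q
    go (affine x y) (affine x' y') e₁ e₂ e₃ = cong₂ affine (scale e₁ e₂) (scale e₁ e₃)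
    go (affine x y) (infty x')     e₁ e₂ e₃ = contradiction e₁ 1≢k0
    go (affine x y) vert           e₁ e₂ e₃ = contradiction e₁ 1≢k0
    go (infty x)    (affine x' y') e₁ e₂ e₃ = contradiction e₂ (k≢0 e₁)
    go (infty x)    (infty x')     e₁ e₂ e₃ = cong infty (scale e₂ e₃)
    go (infty x)    vert           e₁ e₂ e₃ = contradiction e₂ 1≢k0
    go vert         (affine x' y') e₁ e₂ e₃ = contradiction e₃ (k≢0 e₁)
    go vert         (infty x')     e₁ e₂ e₃ = contradiction e₃ (k≢0 e₂)
    go vert         vert           e₁ e₂ e₃ = refl

  normalise : V → Point
  normalise (x , y , z) with x ≟ 0# | y ≟ 0#
  ... | no _  | _     = affine (x ⁻¹ * y) (x ⁻¹ * z)
  ... | yes _ | no _  = infty (y ⁻¹ * z)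
  -- The zero vector also lands here, whence the hypothesis `v ≢ 𝟎` in `normalise-proportional`.
  ... | yes _ | yes _ = vert

  normalise-proportional : ∀ v → v ≢ 𝟎 → ∃ λ k → k ≢ 0# × v ≡ k ⊙ coords (normalise v)
  normalise-proportional (x , y , z) v≢𝟎 with x ≟ 0# | y ≟ 0#
  ... | no x≢0  | _ = x , x≢0 ,
    ≡-vec (sym (*-identityʳ x)) (sym (x*[x⁻¹*y]≡y y x≢0)) (sym (x*[x⁻¹*y]≡y z x≢0))
  ... | yes x≡0 | no y≢0 = y , y≢0 ,
    ≡-vec (trans x≡0 (sym (zeroʳ y))) (sym (*-identityʳ y)) (sym (x*[x⁻¹*y]≡y z y≢0))
  ... | yes x≡0 | yes y≡0 = z , (λ z≡0 → v≢𝟎 (≡-vec x≡0 y≡0 z≡0)) ,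
    ≡-vec (trans x≡0 (sym (zeroʳ z))) (trans y≡0 (sym (zeroʳ z))) (sym (*-identityʳ z))

  normalise-unique : ∀ v P → v ≡ coords P → normalise v ≡ P
  normalise-unique v P refl with normalise-proportional v (coords≢𝟎 P)
  ... | k , _ , eq = sym (coords-proportional P (normalise v) k eq)

  -- Points are nonzero vectors up to scalars, so a homogeneous bijection of `V` descends to a
  -- bijection of points. Incidence is treated in `Frame`.
  module Projectivity (f g : V → V)
    (f-⊙ : ∀ k v → f (k ⊙ v) ≡ k ⊙ f v) (g-⊙ : ∀ k v → g (k ⊙ v) ≡ k ⊙ g v)
    (g∘f : ∀ v → g (f v) ≡ v) (f∘g : ∀ v → f (g v) ≡ v) where

    image : Point → Point
    image P = normalise (f (coords P))

    private
      zero-⊙ : ∀ (h : V → V) → (∀ k v → h (k ⊙ v) ≡ k ⊙ h v) → h 𝟎 ≡ 𝟎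
      zero-⊙ h h-⊙ = begin
        h 𝟎            ≡⟨ cong h (sym (0⊙ 𝟎)) ⟩
        h (0# ⊙ 𝟎)     ≡⟨ h-⊙ 0# 𝟎 ⟩
        0# ⊙ h 𝟎       ≡⟨ 0⊙ (h 𝟎) ⟩
        𝟎              ∎
        where
        open ≡-Reasoning
        0⊙ : ∀ v → 0# ⊙ v ≡ 𝟎
        0⊙ (x , y , z) = ≡-vec (zeroˡ x) (zeroˡ y) (zeroˡ z)

    image-proportional : ∀ P → ∃ λ k → k ≢ 0# × f (coords P) ≡ k ⊙ coords (image P)
    image-proportional P = normalise-proportional (f (coords P)) λ fP≡𝟎 →
      coords≢𝟎 P (trans (sym (g∘f (coords P))) (trans (cong g fP≡𝟎) (zero-⊙ g g-⊙)))

    image-injective : ∀ {P Q} → image P ≡ image Q → P ≡ Q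
    image-injective {P} {Q} eq with image-proportional P | image-proportional Q
    ... | k , k≢0 , fP | l , l≢0 , fQ = coords-proportional P Q (k * l ⁻¹) (begin
      coords P                          ≡⟨ pull P k fP ⟩
      k ⊙ g (coords (image P))          ≡⟨ cong (λ R → k ⊙ g (coords R)) eq ⟩
      k ⊙ g (coords (image Q))          ≡⟨ cong (_⊙ _) (sym k*l⁻¹*l≡k) ⟩
      (k * l ⁻¹ * l) ⊙ g (coords (image Q)) ≡⟨ ⊙-assoc (k * l ⁻¹) l _ ⟨
      (k * l ⁻¹) ⊙ l ⊙ g (coords (image Q)) ≡⟨ cong ((k * l ⁻¹) ⊙_) (pull Q l fQ) ⟨
      (k * l ⁻¹) ⊙ coords Q             ∎)
      where
      open ≡-Reasoning
      k*l⁻¹*l≡k : k * l ⁻¹ * l ≡ k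
      k*l⁻¹*l≡k = trans (*-assoc k (l ⁻¹) l) (trans (cong (k *_) (inverseˡ l l≢0)) (*-identityʳ k))
      pull : ∀ P k → f (coords P) ≡ k ⊙ coords (image P) → coords P ≡ k ⊙ g (coords (image P))
      pull P k fP = trans (sym (g∘f (coords P))) (trans (cong g fP) (g-⊙ k _))

    image-surjective : ∀ Q → ∃ λ P → Q ≡ image P
    image-surjective Q with normalise-proportional (g (coords Q)) (λ gQ≡𝟎 →
      coords≢𝟎 Q (trans (sym (f∘g (coords Q))) (trans (cong f gQ≡𝟎) (zero-⊙ f f-⊙))))
    ... | k , _ , gQ with image-proportional (normalise (g (coords Q)))
    ... | l , _ , fP = P , coords-proportional Q (image P) (k * l) (begin
      coords Q                      ≡⟨ f∘g (coords Q) ⟨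
      f (g (coords Q))              ≡⟨ cong f gQ ⟩
      f (k ⊙ coords P)              ≡⟨ f-⊙ k (coords P) ⟩
      k ⊙ f (coords P)              ≡⟨ cong (k ⊙_) fP ⟩
      k ⊙ l ⊙ coords (image P)      ≡⟨ ⊙-assoc k l _ ⟩
      (k * l) ⊙ coords (image P)    ∎)
      where
      open ≡-Reasoning
      P = normalise (g (coords Q))

  -- A vanishing cross product makes the vectors proportional; the factor is the coordinate of `Q`
  -- at the position where `P` has its leading 1.
  ⊗≡𝟎⇒≡ : ∀ P Q → coords P ⊗ coords Q ≡ 𝟎 → P ≡ Q
  ⊗≡𝟎⇒≡ P Q eq = sym (go P (coords Q) (coords-proportional Q P) (cong proj₁ eq)
                        (cong (proj₁ ∘ proj₂) eq) (cong (proj₂ ∘ proj₂) eq))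
    where
    flip : ∀ x a c → 1# * x + - (a * c) ≡ 0# → x ≡ c * a
    flip x a c eq =
      trans (sym (*-identityˡ x)) (trans (x-y≡0⇒x≡y _ _ eq) (*-comm a c))
    flip' : ∀ x a c → a * c + - (1# * x) ≡ 0# → x ≡ c * a
    flip' x a c eq =
      trans (sym (*-identityˡ x)) (trans (sym (x-y≡0⇒x≡y _ _ eq)) (*-comm a c))
    go : ∀ P {R : Set} (v : V) → (∀ k → v ≡ k ⊙ coords P → R) →
      proj₁ (coords P ⊗ v) ≡ 0# → proj₁ (proj₂ (coords P ⊗ v)) ≡ 0# →
      proj₂ (proj₂ (coords P ⊗ v)) ≡ 0# → R
    go (affine x y) (a , b , c) prop e₁ e₂ e₃ =
      prop a (≡-vec (sym (*-identityʳ a)) (flip b x a e₃) (flip' c y a e₂))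
    go (infty x) (a , b , c) prop e₁ e₂ e₃ =
      prop b (≡-vec (flip' a 0# b e₃) (sym (*-identityʳ b)) (flip c x b e₁))
    go vert (a , b , c) prop e₁ e₂ e₃ =
      prop c (≡-vec (flip a 0# c e₂) (flip' b 0# c e₁) (sym (*-identityʳ c)))

  -- Applied to the cross product of two line vectors, it yields a third vector completing them to a
  -- frame of determinant 1.
  dual-vector : ∀ v → v ≢ 𝟎 → ∃ λ w → dot v w ≡ 1#
  dual-vector (x , y , z) v≢𝟎 with x ≟ 0# | y ≟ 0# | z ≟ 0#
  ... | no x≢0 | _ | _ = (x ⁻¹ , 0# , 0#) , trans
    (cong₂ _+_ (trans (cong₂ _+_ (inverseʳ x x≢0) (zeroʳ y)) (+-identityʳ 1#)) (zeroʳ z)) (+-identityʳ 1#)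
  ... | yes _ | no y≢0 | _ = (0# , y ⁻¹ , 0#) , trans
    (cong₂ _+_ (trans (cong₂ _+_ (zeroʳ x) (inverseʳ y y≢0)) (+-identityˡ 1#)) (zeroʳ z)) (+-identityʳ 1#)
  ... | yes _ | yes _ | no z≢0 = (0# , 0# , z ⁻¹) , trans
    (cong₂ _+_ (trans (cong₂ _+_ (zeroʳ x) (zeroʳ y)) (+-identityˡ 0#)) (inverseʳ z z≢0)) (+-identityˡ 1#)
  ... | yes x≡0 | yes y≡0 | yes z≡0 = contradiction (≡-vec x≡0 y≡0 z≡0) v≢𝟎

-- Coordinates adapted to two lines.

module Coordinates {q : ℕ} (F : FiniteField q) where
  open FiniteField F
  open PG2 F
  open FieldTheory F
  open Plane F
  open CommutativeRing commutativeRing using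
    ( +-comm; +-identityˡ; +-identityʳ; *-comm; *-identityˡ
    ; *-identityʳ; zeroˡ; zeroʳ; -‿inverseʳ; ring
    )
  open import Algebra.Properties.Ring ring using (-0#≈0#; -‿distribʳ-*; -‿involutive)
  open RingSolver commutativeRing using (Polynomial; solve; _:=_; _:+_; _:*_; :-_)

  -- As a line, affine m k is y = m x + k, infty k is x = - k and vert is the line at infinity.
  Inc : Point → Point → Set
  Inc (affine b c) (affine m k) = c ≡ m * b + k
  Inc (affine b c) (infty k)    = k + b ≡ 0#
  Inc (affine b c) vert         = ⊥
  Inc (infty x)    (affine m k) = x ≡ m
  Inc (infty x)    (infty k)    = ⊥
  Inc (infty x)    vert         = ⊤
  Inc vert         (affine m k) = ⊥
  Inc vert         (infty k)    = ⊤
  Inc vert         vert         = ⊤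

  -- flip sends the coordinates of a line to the covector whose zeros are given by Inc.
  flip unflip : V → V
  flip (x , y , z) = z , y , - x
  unflip (u , v , w) = - w , v , u

  incidence : Point → Point → Carrier
  incidence P L = dot (coords P) (flip (coords L))

  private
    sum₃ : ∀ {r s t r' s' t'} → r ≡ r' → s ≡ s' → t ≡ t' → r + s + t ≡ r' + s' + t'
    sum₃ refl refl refl = refl

    x+0+0 : ∀ x → x + 0# + 0# ≡ x
    x+0+0 x = trans (+-identityʳ _) (+-identityʳ x)

    0+x+0 : ∀ x → 0# + x + 0# ≡ x
    0+x+0 x = trans (+-identityʳ _) (+-identityˡ x)

    0+0+x : ∀ x → 0# + 0# + x ≡ x
    0+0+x x = trans (cong (_+ x) (+-identityˡ 0#)) (+-identityˡ x)

    x*-0 : ∀ x → x * - 0# ≡ 0#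
    x*-0 x = trans (cong (x *_) -0#≈0#) (zeroʳ x)

    -0* : ∀ x → - 0# * x ≡ 0#
    -0* x = trans (cong (_* x) -0#≈0#) (zeroˡ x)

    0≢-1 : 0# ≢ - 1#
    0≢-1 eq = 0≢1 (sym (x-y≡0⇒x≡y 1# 0# (trans (cong (1# +_) (trans -0#≈0# eq)) (-‿inverseʳ 1#))))

  incidence-value : Point → Point → Carrier
  incidence-value (affine b c) (affine m k) = m * b + k + - c
  incidence-value (affine b c) (infty k)    = k + b
  incidence-value (affine b c) vert         = 1#
  incidence-value (infty x)    (affine m k) = m + - x
  incidence-value (infty x)    (infty k)    = 1#
  incidence-value (infty x)    vert         = 0#
  incidence-value vert         (affine m k) = - 1#
  incidence-value vert         (infty k)    = 0#
  incidence-value vert         vert         = 0#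

  incidence≡ : ∀ P L → incidence P L ≡ incidence-value P L
  incidence≡ (affine b c) (affine m k) =
    trans (sum₃ (*-identityˡ k) (*-comm b m) (trans (sym (-‿distribʳ-* c 1#)) (cong -_ (*-identityʳ c))))
      (cong (_+ - c) (+-comm k (m * b)))
  incidence≡ (affine b c) (infty k) =
    trans (sum₃ (*-identityˡ k) (*-identityʳ b) (x*-0 c)) (+-identityʳ _)
  incidence≡ (affine b c) vert =
    trans (sum₃ (*-identityˡ 1#) (zeroʳ b) (x*-0 c)) (x+0+0 1#)
  incidence≡ (infty x) (affine m k) =
    trans (sum₃ (zeroˡ k) (*-identityˡ m) (trans (sym (-‿distribʳ-* x 1#)) (cong -_ (*-identityʳ x))))
      (cong (_+ - x) (+-identityˡ m))
  incidence≡ (infty x) (infty k) =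
    trans (sum₃ (zeroˡ k) (*-identityˡ 1#) (x*-0 x)) (0+x+0 1#)
  incidence≡ (infty x) vert =
    trans (sum₃ (zeroˡ 1#) (zeroʳ 1#) (x*-0 x)) (x+0+0 0#)
  incidence≡ vert (affine m k) =
    trans (sum₃ (zeroˡ k) (zeroˡ m) (*-identityˡ (- 1#))) (0+0+x (- 1#))
  incidence≡ vert (infty k) =
    trans (sum₃ (zeroˡ k) (zeroˡ 1#) (x*-0 1#)) (x+0+0 0#)
  incidence≡ vert vert =
    trans (sum₃ (zeroˡ 1#) (zeroˡ 0#) (x*-0 1#)) (x+0+0 0#)

  incidence≡0⇒Inc : ∀ P L → incidence P L ≡ 0# → Inc P L
  incidence≡0⇒Inc P L eq = go P L (trans (sym (incidence≡ P L)) eq)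
    where
    go : ∀ P L → incidence-value P L ≡ 0# → Inc P L
    go (affine b c) (affine m k) eq = sym (x-y≡0⇒x≡y _ _ eq)
    go (affine b c) (infty k)    eq = eq
    go (affine b c) vert         eq = 0≢1 (sym eq)
    go (infty x)    (affine m k) eq = sym (x-y≡0⇒x≡y _ _ eq)
    go (infty x)    (infty k)    eq = 0≢1 (sym eq)
    go (infty x)    vert         eq = tt
    go vert         (affine m k) eq = 0≢-1 (sym eq)
    go vert         (infty k)    eq = tt
    go vert         vert         eq = tt

  Inc⇒incidence≡0 : ∀ P L → Inc P L → incidence P L ≡ 0#
  Inc⇒incidence≡0 P L inc = trans (incidence≡ P L) (go P L inc)
    where
    go : ∀ P L → Inc P L → incidence-value P L ≡ 0#
    go (affine b c) (affine m k) eq = x≡y⇒x-y≡0 (sym eq)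
    go (affine b c) (infty k)    eq = eq
    go (infty x)    (affine m k) eq = x≡y⇒x-y≡0 (sym eq)
    go (infty x)    vert         eq = refl
    go vert         (infty k)    eq = refl
    go vert         vert         eq = refl

  det : V → V → V → Carrier
  det a b c = dot (a ⊗ b) c

  private
    -- Syntactic copies of the vector operations, so that polynomial identities can be given to the
    -- solver in vector notation. The 12 variables are the entries of `a`, `b`, `c` and `p`.
    Vₚ : Set
    Vₚ = Polynomial 12 × Polynomial 12 × Polynomial 12

    dotₚ : Vₚ → Vₚ → Polynomial 12
    dotₚ (a , b , c) (x , y , z) = a :* x :+ b :* y :+ c :* z

    _⊗ₚ_ : Vₚ → Vₚ → Vₚ
    (a , b , c) ⊗ₚ (x , y , z) =
      b :* z :+ :- (c :* y) , c :* x :+ :- (a :* z) , a :* y :+ :- (b :* x)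

    detₚ : Vₚ → Vₚ → Vₚ → Polynomial 12
    detₚ a b c = dotₚ (a ⊗ₚ b) c

    combineₚ : Vₚ → Vₚ → Vₚ → Vₚ → Vₚ
    combineₚ (a₁ , a₂ , a₃) (b₁ , b₂ , b₃) (c₁ , c₂ , c₃) (u , v , w) =
      u :* a₁ :+ v :* b₁ :+ w :* c₁ , u :* a₂ :+ v :* b₂ :+ w :* c₂ , u :* a₃ :+ v :* b₃ :+ w :* c₃

    vectors : {A : Set} → (Vₚ → Vₚ → Vₚ → Vₚ → A) → (a₁ a₂ a₃ b₁ b₂ b₃ c₁ c₂ c₃ u v w : Polynomial 12) → A
    vectors f a₁ a₂ a₃ b₁ b₂ b₃ c₁ c₂ c₃ u v w =
      f (a₁ , a₂ , a₃) (b₁ , b₂ , b₃) (c₁ , c₂ , c₃) (u , v , w)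

    onVectors : {P : V → V → V → V → Set} →
      (∀ a₁ a₂ a₃ b₁ b₂ b₃ c₁ c₂ c₃ u v w → P (a₁ , a₂ , a₃) (b₁ , b₂ , b₃) (c₁ , c₂ , c₃) (u , v , w)) →
      ∀ a b c p → P a b c p
    onVectors h (a₁ , a₂ , a₃) (b₁ , b₂ , b₃) (c₁ , c₂ , c₃) (u , v , w) =
      h a₁ a₂ a₃ b₁ b₂ b₃ c₁ c₂ c₃ u v w

  x̂ ŷ ẑ : {A : Set} → A × A × A → A
  x̂ (x , _ , _) = x
  ŷ (_ , y , _) = y
  ẑ (_ , _ , z) = z

  -- The matrix with columns `a`, `b`, `c`, and its transpose.
  combine dots : V → V → V → V → V
  combine (a₁ , a₂ , a₃) (b₁ , b₂ , b₃) (c₁ , c₂ , c₃) (u , v , w) =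
    u * a₁ + v * b₁ + w * c₁ , u * a₂ + v * b₂ + w * c₂ , u * a₃ + v * b₃ + w * c₃
  dots a b c p = dot a p , dot b p , dot c p

  -- The vectors `b ⊗ c`, `c ⊗ a`, `a ⊗ b` are the columns of the adjugate of the matrix with rows
  -- `a`, `b`, `c`. This and the three similar lemmas below are the adjugate identity, on either
  -- side, for that matrix and for its transpose.
  dots-combine : ∀ a b c p → dots a b c (combine (b ⊗ c) (c ⊗ a) (a ⊗ b) p) ≡ det a b c ⊙ p
  dots-combine a b c p@(_ , _ , _) = ≡-vec (i a b c p) (j a b c p) (k a b c p)
    where
    i : ∀ a b c p → dot a (combine (b ⊗ c) (c ⊗ a) (a ⊗ b) p) ≡ det a b c * x̂ p
    i = onVectors (solve 12 (vectors λ a b c p →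
      dotₚ a (combineₚ (b ⊗ₚ c) (c ⊗ₚ a) (a ⊗ₚ b) p) := detₚ a b c :* x̂ p) refl)
    j : ∀ a b c p → dot b (combine (b ⊗ c) (c ⊗ a) (a ⊗ b) p) ≡ det a b c * ŷ p
    j = onVectors (solve 12 (vectors λ a b c p →
      dotₚ b (combineₚ (b ⊗ₚ c) (c ⊗ₚ a) (a ⊗ₚ b) p) := detₚ a b c :* ŷ p) refl)
    k : ∀ a b c p → dot c (combine (b ⊗ c) (c ⊗ a) (a ⊗ b) p) ≡ det a b c * ẑ p
    k = onVectors (solve 12 (vectors λ a b c p →
      dotₚ c (combineₚ (b ⊗ₚ c) (c ⊗ₚ a) (a ⊗ₚ b) p) := detₚ a b c :* ẑ p) refl)

  dots-combine′ : ∀ a b c p → dots (b ⊗ c) (c ⊗ a) (a ⊗ b) (combine a b c p) ≡ det a b c ⊙ p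
  dots-combine′ a b c p@(_ , _ , _) = ≡-vec (i a b c p) (j a b c p) (k a b c p)
    where
    i : ∀ a b c p → dot (b ⊗ c) (combine a b c p) ≡ det a b c * x̂ p
    i = onVectors (solve 12 (vectors λ a b c p →
      dotₚ (b ⊗ₚ c) (combineₚ a b c p) := detₚ a b c :* x̂ p) refl)
    j : ∀ a b c p → dot (c ⊗ a) (combine a b c p) ≡ det a b c * ŷ p
    j = onVectors (solve 12 (vectors λ a b c p →
      dotₚ (c ⊗ₚ a) (combineₚ a b c p) := detₚ a b c :* ŷ p) refl)
    k : ∀ a b c p → dot (a ⊗ b) (combine a b c p) ≡ det a b c * ẑ p
    k = onVectors (solve 12 (vectors λ a b c p →
      dotₚ (a ⊗ₚ b) (combineₚ a b c p) := detₚ a b c :* ẑ p) refl)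

  private
    dotsₚ : Vₚ → Vₚ → Vₚ → Vₚ → Vₚ
    dotsₚ a b c p = dotₚ a p , dotₚ b p , dotₚ c p

  combine-dots : ∀ a b c p → combine (b ⊗ c) (c ⊗ a) (a ⊗ b) (dots a b c p) ≡ det a b c ⊙ p
  combine-dots a b c p@(_ , _ , _) = ≡-vec (i a b c p) (j a b c p) (k a b c p)
    where
    i : ∀ a b c p → x̂ (combine (b ⊗ c) (c ⊗ a) (a ⊗ b) (dots a b c p)) ≡ det a b c * x̂ p
    i = onVectors (solve 12 (vectors λ a b c p →
      x̂ (combineₚ (b ⊗ₚ c) (c ⊗ₚ a) (a ⊗ₚ b) (dotsₚ a b c p)) := detₚ a b c :* x̂ p) refl)
    j : ∀ a b c p → ŷ (combine (b ⊗ c) (c ⊗ a) (a ⊗ b) (dots a b c p)) ≡ det a b c * ŷ p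
    j = onVectors (solve 12 (vectors λ a b c p →
      ŷ (combineₚ (b ⊗ₚ c) (c ⊗ₚ a) (a ⊗ₚ b) (dotsₚ a b c p)) := detₚ a b c :* ŷ p) refl)
    k : ∀ a b c p → ẑ (combine (b ⊗ c) (c ⊗ a) (a ⊗ b) (dots a b c p)) ≡ det a b c * ẑ p
    k = onVectors (solve 12 (vectors λ a b c p →
      ẑ (combineₚ (b ⊗ₚ c) (c ⊗ₚ a) (a ⊗ₚ b) (dotsₚ a b c p)) := detₚ a b c :* ẑ p) refl)

  combine-dots′ : ∀ a b c p → combine a b c (dots (b ⊗ c) (c ⊗ a) (a ⊗ b) p) ≡ det a b c ⊙ p
  combine-dots′ a b c p@(_ , _ , _) = ≡-vec (i a b c p) (j a b c p) (k a b c p)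
    where
    i : ∀ a b c p → x̂ (combine a b c (dots (b ⊗ c) (c ⊗ a) (a ⊗ b) p)) ≡ det a b c * x̂ p
    i = onVectors (solve 12 (vectors λ a b c p →
      x̂ (combineₚ a b c (dotsₚ (b ⊗ₚ c) (c ⊗ₚ a) (a ⊗ₚ b) p)) := detₚ a b c :* x̂ p) refl)
    j : ∀ a b c p → ŷ (combine a b c (dots (b ⊗ c) (c ⊗ a) (a ⊗ b) p)) ≡ det a b c * ŷ p
    j = onVectors (solve 12 (vectors λ a b c p →
      ŷ (combineₚ a b c (dotsₚ (b ⊗ₚ c) (c ⊗ₚ a) (a ⊗ₚ b) p)) := detₚ a b c :* ŷ p) refl)
    k : ∀ a b c p → ẑ (combine a b c (dots (b ⊗ c) (c ⊗ a) (a ⊗ b) p)) ≡ det a b c * ẑ p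
    k = onVectors (solve 12 (vectors λ a b c p →
      ẑ (combineₚ a b c (dotsₚ (b ⊗ₚ c) (c ⊗ₚ a) (a ⊗ₚ b) p)) := detₚ a b c :* ẑ p) refl)

  dot-combine : ∀ a b c p w → dot (combine a b c p) w ≡ dot p (dots a b c w)
  dot-combine (a₁ , a₂ , a₃) (b₁ , b₂ , b₃) (c₁ , c₂ , c₃) (u , v , w) (x , y , z) =
    solve 15 (λ x y z a₁ a₂ a₃ b₁ b₂ b₃ c₁ c₂ c₃ u v w →
      (u :* a₁ :+ v :* b₁ :+ w :* c₁) :* x :+ (u :* a₂ :+ v :* b₂ :+ w :* c₂) :* y
        :+ (u :* a₃ :+ v :* b₃ :+ w :* c₃) :* z :=
      u :* (a₁ :* x :+ a₂ :* y :+ a₃ :* z) :+ v :* (b₁ :* x :+ b₂ :* y :+ b₃ :* z)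
        :+ w :* (c₁ :* x :+ c₂ :* y :+ c₃ :* z))
      refl x y z a₁ a₂ a₃ b₁ b₂ b₃ c₁ c₂ c₃ u v w

  combine-⊙ : ∀ a b c k p → combine a b c (k ⊙ p) ≡ k ⊙ combine a b c p
  combine-⊙ (a₁ , a₂ , a₃) (b₁ , b₂ , b₃) (c₁ , c₂ , c₃) k (u , v , w) =
    ≡-vec (factor k u v w a₁ b₁ c₁) (factor k u v w a₂ b₂ c₂) (factor k u v w a₃ b₃ c₃)
    where
    factor : ∀ k u v w a b c → k * u * a + k * v * b + k * w * c ≡ k * (u * a + v * b + w * c)
    factor = solve 7 (λ k u v w a b c →
      k :* u :* a :+ k :* v :* b :+ k :* w :* c := k :* (u :* a :+ v :* b :+ w :* c)) refl

  dots-⊙ : ∀ a b c k p → dots a b c (k ⊙ p) ≡ k ⊙ dots a b c p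
  dots-⊙ a b c k p = ≡-vec (dot-⊙ʳ a) (dot-⊙ʳ b) (dot-⊙ʳ c)
    where
    dot-⊙ʳ : ∀ a → dot a (k ⊙ p) ≡ k * dot a p
    dot-⊙ʳ a = trans (cong (λ a → dot a (k ⊙ p)) (sym (1⊙ a)))
      (trans (dot-⊙ 1# k a p) (cong (_* dot a p) (*-identityˡ k)))

  flip-⊙ : ∀ k v → flip (k ⊙ v) ≡ k ⊙ flip v
  flip-⊙ k (x , y , z) = ≡-vec refl refl (-‿distribʳ-* k x)

  unflip-⊙ : ∀ k v → unflip (k ⊙ v) ≡ k ⊙ unflip v
  unflip-⊙ k (x , y , z) = ≡-vec (-‿distribʳ-* k z) refl refl

  unflip-flip : ∀ v → unflip (flip v) ≡ v
  unflip-flip (x , y , z) = ≡-vec (-‿involutive x) refl refl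

  flip-unflip : ∀ v → flip (unflip v) ≡ v
  flip-unflip (x , y , z) = ≡-vec refl refl (-‿involutive z)

  -- Up to det, b ⊗ c, c ⊗ a and a ⊗ b form the basis dual to a, b, c: using the former for points
  -- and the latter for lines preserves incidence and makes a and b the lines vert and infty 0#.
  module Frame (a b c : V) (det≡1 : det a b c ≡ 1#) where

    private
      by-det : ∀ {v} p → v ≡ det a b c ⊙ p → v ≡ p
      by-det p eq = trans eq (trans (cong (_⊙ p) det≡1) (1⊙ p))

      f g f′ g′ : V → V
      f p  = combine (b ⊗ c) (c ⊗ a) (a ⊗ b) p
      g p  = dots a b c p
      f′ l = combine a b c (flip l)
      g′ l = unflip (dots (b ⊗ c) (c ⊗ a) (a ⊗ b) l)

    module Points = Projectivity f g
      (λ k p → combine-⊙ (b ⊗ c) (c ⊗ a) (a ⊗ b) k p) (λ k p → dots-⊙ a b c k p)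
      (λ p → by-det p (dots-combine a b c p)) (λ p → by-det p (combine-dots a b c p))

    module Lines = Projectivity f′ g′
      (λ k l → trans (cong (combine a b c) (flip-⊙ k l)) (combine-⊙ a b c k (flip l)))
      (λ k l → trans (cong unflip (dots-⊙ (b ⊗ c) (c ⊗ a) (a ⊗ b) k l))
        (unflip-⊙ k (dots (b ⊗ c) (c ⊗ a) (a ⊗ b) l)))
      (λ l → trans (cong unflip (by-det (flip l) (dots-combine′ a b c (flip l)))) (unflip-flip l))
      (λ l → trans (cong (combine a b c) (flip-unflip (dots (b ⊗ c) (c ⊗ a) (a ⊗ b) l)))
        (by-det l (combine-dots′ a b c l)))

    incidence-preserved : ∀ P L → dot (f (coords P)) (f′ (coords L)) ≡ incidence P L
    incidence-preserved P L =
      trans (dot-combine (b ⊗ c) (c ⊗ a) (a ⊗ b) (coords P) (f′ (coords L)))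
        (cong (dot (coords P)) (by-det (flip (coords L)) (dots-combine′ a b c (flip (coords L)))))

    incidence-scaled : ∀ P L → ∃ λ k → k ≢ 0# ×
      incidence P L ≡ k * dot (coords (Points.image P)) (coords (Lines.image L))
    incidence-scaled P L = go (Points.image-proportional P) (Lines.image-proportional L)
      where
      go : ∀ {v w} → (∃ λ k → k ≢ 0# × f (coords P) ≡ k ⊙ v) → (∃ λ l → l ≢ 0# × f′ (coords L) ≡ l ⊙ w) →
        ∃ λ m → m ≢ 0# × incidence P L ≡ m * dot v w
      go {v} {w} (k , k≢0 , fP) (l , l≢0 , f′L) = k * l , *-≢0 k≢0 l≢0 ,
        trans (sym (incidence-preserved P L)) (trans (cong₂ dot fP f′L) (dot-⊙ k l v w))

    on⇒Inc : ∀ P L → on (Points.image P) (Lines.image L) ≡ true → Inc P L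
    on⇒Inc P L on≡true = go (incidence-scaled P L)
      (dot (coords (Points.image P)) (coords (Lines.image L)) ≟ 0#) on≡true
      where
      go : ∀ {d} → (∃ λ k → k ≢ 0# × incidence P L ≡ k * d) → (d≟0 : Dec (d ≡ 0#)) →
        does d≟0 ≡ true → Inc P L
      go (k , _ , eq) (yes refl) _ = incidence≡0⇒Inc P L (trans eq (zeroʳ k))

    Inc⇒on : ∀ P L → Inc P L → on (Points.image P) (Lines.image L) ≡ true
    Inc⇒on P L inc = go (incidence-scaled P L)
      (dot (coords (Points.image P)) (coords (Lines.image L)) ≟ 0#)
      where
      go : ∀ {d} → (∃ λ k → k ≢ 0# × incidence P L ≡ k * d) → (d≟0 : Dec (d ≡ 0#)) → does d≟0 ≡ true
      go (k , k≢0 , eq) d≟0 =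
        dec-true d≟0 (*-cancelˡ-0 k≢0 (trans (sym eq) (Inc⇒incidence≡0 P L inc)))

    line-vert : f′ (coords vert) ≡ a
    line-vert = ≡-vec (unit _ _ _) (unit _ _ _) (unit _ _ _)
      where
      unit : ∀ x y z → 1# * x + 0# * y + - 0# * z ≡ x
      unit x y z = trans (sum₃ (*-identityˡ x) (zeroˡ y) (-0* z)) (x+0+0 x)

    line-infty0 : f′ (coords (infty 0#)) ≡ b
    line-infty0 = ≡-vec (unit _ _ _) (unit _ _ _) (unit _ _ _)
      where
      unit : ∀ x y z → 0# * x + 1# * y + - 0# * z ≡ y
      unit x y z = trans (sum₃ (zeroˡ x) (*-identityˡ y) (-0* z)) (0+x+0 y)

  -- All that the combinatorial argument uses of the change of frame. Points and lines have separate
  -- maps, and incidence is expressed by `Inc`, which computes by cases.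
  record Coordinatisation (ℓ₁ ℓ₂ : Line) : Set where
    field
      point line       : Point → Point
      point-injective  : ∀ {P Q} → point P ≡ point Q → P ≡ Q
      point-surjective : ∀ Q → ∃ λ P → Q ≡ point P
      line-injective   : ∀ {P Q} → line P ≡ line Q → P ≡ Q
      line-surjective  : ∀ Q → ∃ λ P → Q ≡ line P
      on⇒Inc           : ∀ P L → on (point P) (line L) ≡ true → Inc P L
      Inc⇒on           : ∀ P L → Inc P L → on (point P) (line L) ≡ true
      line-vert        : line vert ≡ ℓ₁
      line-infty0      : line (infty 0#) ≡ ℓ₂

  frame-coordinatisation : ∀ ℓ₁ ℓ₂ → (∃ λ c → det (coords ℓ₁) (coords ℓ₂) c ≡ 1#) → Coordinatisation ℓ₁ ℓ₂
  frame-coordinatisation ℓ₁ ℓ₂ (c , det≡1) = record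
    { point            = Points.image
    ; line             = Lines.image
    ; point-injective  = Points.image-injective
    ; point-surjective = Points.image-surjective
    ; line-injective   = Lines.image-injective
    ; line-surjective  = Lines.image-surjective
    ; on⇒Inc           = on⇒Inc
    ; Inc⇒on           = Inc⇒on
    ; line-vert        = normalise-unique _ ℓ₁ line-vert
    ; line-infty0      = normalise-unique _ ℓ₂ line-infty0
    }
    where open Frame (coords ℓ₁) (coords ℓ₂) c det≡1

  coordinatise : ∀ {ℓ₁ ℓ₂} → ℓ₁ ≢ ℓ₂ → Coordinatisation ℓ₁ ℓ₂
  coordinatise {ℓ₁} {ℓ₂} ℓ₁≢ℓ₂ = frame-coordinatisation ℓ₁ ℓ₂
    (dual-vector (coords ℓ₁ ⊗ coords ℓ₂) (λ eq → ℓ₁≢ℓ₂ (⊗≡𝟎⇒≡ ℓ₁ ℓ₂ eq)))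

-- Sums and products over subsets of the field.

open Listing

count-all : {A : Set} (as : Listing A) → # (λ _ → true) of as ≡ length (list as)
count-all as = cong length (filter-all (λ _ → true ≟B true) (All.universal (λ _ → refl) (list as)))

module FieldSums {q : ℕ} (F : FiniteField q) where
  open FiniteField F
  open FieldTheory F
  open CommutativeRing commutativeRing using
    ( +-identityˡ; +-identityʳ; *-assoc; *-comm; *-identityˡ; *-identityʳ; zeroˡ
    ; zeroʳ; -‿inverseʳ; distribʳ; semiring; ring; +-isCommutativeMonoid; *-isCommutativeMonoid
    )
  open RingSolver commutativeRing using (solve; _:=_; _:+_; _:*_; :-_)
  open import Algebra.Properties.Ring ring using (+-identityʳ-unique; -0#≈0#)

  module Add = Fold +-isCommutativeMonoid
  module Mul = Fold *-isCommutativeMonoid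
  open Add using () renaming (_·_ to _⋆_; fold to ∑)
  -- The exponent comes first: n ^^ x is xⁿ.
  open Mul using () renaming (_·_ to _^^_; fold to ∏)

  count-field : # (λ _ → true) of field-listing ≡ q
  count-field = trans (count-all field-listing)
    (trans (length-map _ (allFin q)) (length-tabulate id))

  -- Translation by 1 permutes the field, so adding `q ⋆ 1#` does not change the sum of all
  -- elements. This replaces any computation of the characteristic: together with `gcd q t ≡ 1` it
  -- yields `t ⋆ 1# ≢ 0#`.
  q⋆1≡0 : q ⋆ 1# ≡ 0#
  q⋆1≡0 = +-identityʳ-unique (∑ elements) (q ⋆ 1#) (begin
    ∑ elements + q ⋆ 1#
      ≡⟨ cong₂ (λ xs n → ∑ xs + n ⋆ 1#) (sym (map-id elements)) (sym length≡q) ⟩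
    ∑ (map id elements) + length elements ⋆ 1#
      ≡⟨ cong (∑ (map id elements) +_) (Add.fold-const 1# elements) ⟨
    ∑ (map id elements) + ∑ (map (λ _ → 1#) elements)
      ≡⟨ Add.fold-map-∙ id (λ _ → 1#) elements ⟨
    ∑ (map (_+ 1#) elements)
      ≡⟨ Add.fold-↭ translate ⟩
    ∑ elements  ∎)
    where
    open ≡-Reasoning
    length≡q : length elements ≡ q
    length≡q = trans (sym (count-all field-listing)) count-field
    translate : map (_+ 1#) elements ↭ elements
    translate = unique∧set⇒↭
      (map⁺ (λ {x} {y} eq → trans (sym (shift x)) (trans (cong (_+ - 1#) eq) (shift y))) (unique field-listing))
      (unique field-listing)
      (λ _ → complete field-listing _)
      (λ {y} _ → subst (_∈ map (_+ 1#) elements) (unshift y)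
        (∈-map⁺ (_+ 1#) (complete field-listing (y + - 1#))))
      where
      shift : ∀ x → x + 1# + - 1# ≡ x
      shift x = solve 2 (λ x o → x :+ o :+ :- o := x) refl x 1#
      unshift : ∀ x → x + - 1# + 1# ≡ x
      unshift x = solve 2 (λ x o → x :+ :- o :+ o := x) refl x 1#

  coprime⇒⋆1≢0 : ∀ {t} → gcd q t ≡ 1 → t ⋆ 1# ≢ 0#
  coprime⇒⋆1≢0 {t} coprime t⋆1≡0 = 0≢1 (sym (Add.coprime-order q t 1# coprime q⋆1≡0 t⋆1≡0))

  ⋆≡⋆1* : ∀ n x → n ⋆ x ≡ (n ⋆ 1#) * x
  ⋆≡⋆1* n x = trans (cong (n ⋆_) (sym (*-identityˡ x)))
    (sym (SemiringMult.×-assoc-* semiring n 1# x))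

  ∑-*ʳ : ∀ a xs → ∑ (map (_* a) xs) ≡ ∑ xs * a
  ∑-*ʳ a [] = sym (zeroˡ a)
  ∑-*ʳ a (x ∷ xs) = trans (cong (x * a +_) (∑-*ʳ a xs)) (sym (distribʳ a x (∑ xs)))

  -- The form `k + a * (x + - m)` displays a base point: `m` goes to `k`, and differences from the
  -- base points are scaled by `a`.
  affine-map-injective : ∀ {a} k m → a ≢ 0# → ∀ {x y} → k + a * (x + - m) ≡ k + a * (y + - m) → x ≡ y
  affine-map-injective {a} k m a≢0 {x} {y} eq = *-cancelˡ x y a≢0 (begin
    a * x                                   ≡⟨ recover k a m x ⟩
    (k + a * (x + - m)) + (a * m + - k)     ≡⟨ cong (_+ (a * m + - k)) eq ⟩
    (k + a * (y + - m)) + (a * m + - k)     ≡⟨ recover k a m y ⟨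
    a * y                                   ∎)
    where
    open ≡-Reasoning
    recover : ∀ k a m x → a * x ≡ (k + a * (x + - m)) + (a * m + - k)
    recover = solve 4 (λ k a m x → a :* x := (k :+ a :* (x :+ :- m)) :+ (a :* m :+ :- k)) refl

  affine-map-surjective : ∀ {a} k m → a ≢ 0# → ∀ y → ∃ λ x → y ≡ k + a * (x + - m)
  affine-map-surjective {a} k m a≢0 y = a ⁻¹ * (y + - k) + m , sym (begin
    k + a * (a ⁻¹ * (y + - k) + m + - m)   ≡⟨ regroup k a (a ⁻¹ * (y + - k)) m ⟩
    k + a * (a ⁻¹ * (y + - k))             ≡⟨ cong (k +_) (x*[x⁻¹*y]≡y (y + - k) a≢0) ⟩
    k + (y + - k)                          ≡⟨ solve 2 (λ k y → k :+ (y :+ :- k) := y) refl k y ⟩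
    y                                      ∎)
    where
    open ≡-Reasoning
    regroup : ∀ k a z m → k + a * (z + m + - m) ≡ k + a * z
    regroup = solve 4 (λ k a z m → k :+ a :* (z :+ m :+ :- m) := k :+ a :* z) refl

  affine-map-fixed : ∀ {a} k m → a ≢ 0# → ∀ x → does (x ≟ m) ≡ does ((k + a * (x + - m)) ≟ k)
  affine-map-fixed {a} k m a≢0 x with x ≟ m
  ... | yes refl = sym (dec-true (_ ≟ k) fixed)
    where
    fixed : k + a * (m + - m) ≡ k
    fixed = trans (cong (λ z → k + a * z) (-‿inverseʳ m)) (trans (cong (k +_) (zeroʳ a)) (+-identityʳ k))
  ... | no x≢m = sym (dec-false (_ ≟ k) λ eq → x≢m (x-y≡0⇒x≡y x m
    (*-cancelˡ-0 a≢0 (+-identityʳ-unique k (a * (x + - m)) eq))))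

  ^^-≢0 : ∀ n {x} → x ≢ 0# → n ^^ x ≢ 0#
  ^^-≢0 zero x≢0 1≡0 = 0≢1 (sym 1≡0)
  ^^-≢0 (suc n) x≢0 = *-≢0 x≢0 (^^-≢0 n x≢0)

  -- Up to sign, the value at `m` of the monic polynomial whose simple roots are the elements of
  -- `u`.
  ∏-differences : (Carrier → Bool) → Carrier → Carrier
  ∏-differences u m = ∏ (map (λ x → x + - m) (select u elements))

  ∏-differences-≢0 : ∀ u m → u m ≡ false → ∏-differences u m ≢ 0#
  ∏-differences-≢0 u m um≡false = go (select u elements) (∈-select⁻ field-listing u)
    where
    go : ∀ xs → (∀ {x} → x ∈ xs → u x ≡ true) → ∏ (map (λ x → x + - m) xs) ≢ 0#
    go [] _ 1≡0 = 0≢1 (sym 1≡0)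
    go (x ∷ xs) all-u = *-≢0
      (λ x-m≡0 → case trans (sym (all-u (here refl)))
        (trans (cong u (x-y≡0⇒x≡y x m x-m≡0)) um≡false) of λ ())
      (go xs (all-u ∘ there))

  -- Each factor `y - k` over `u₂` is `a` times a factor `x - m` over `u₁`, so `a` is collected once
  -- for every element of `u₁`.
  ∏-differences-affine : ∀ {a} u₁ u₂ k m → a ≢ 0# → (∀ x → u₁ x ≡ u₂ (k + a * (x + - m))) →
    ∏-differences u₂ k ≡ ((# u₁ of field-listing) ^^ a) * ∏-differences u₁ m
  ∏-differences-affine {a} u₁ u₂ k m a≢0 u₁≡u₂ = begin
    ∏ (map (λ y → y + - k) (select u₂ elements))             ≡⟨ Mul.fold-↭ (↭-map⁺ (λ y → y + - k) image) ⟨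
    ∏ (map (λ y → y + - k) (map φ xs))                       ≡⟨ cong ∏ (map-∘ xs) ⟨
    ∏ (map (λ x → φ x + - k) xs)                             ≡⟨ cong ∏ (map-cong (λ x → simplify k (a * (x + - m))) xs) ⟩
    ∏ (map (λ x → a * (x + - m)) xs)                         ≡⟨ Mul.fold-map-∙ (λ _ → a) (λ x → x + - m) xs ⟩
    ∏ (map (λ _ → a) xs) * ∏-differences u₁ m                ≡⟨ cong (_* ∏-differences u₁ m) (Mul.fold-const a xs) ⟩
    ((# u₁ of field-listing) ^^ a) * ∏-differences u₁ m      ∎
    where
    open ≡-Reasoning
    φ = λ x → k + a * (x + - m)
    xs = select u₁ elements
    image = select-image-↭ field-listing field-listing φ (affine-map-injective k m a≢0) u₁ u₂ u₁≡u₂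
              (λ y _ → affine-map-surjective k m a≢0 y)
    simplify : ∀ k z → k + z + - k ≡ z
    simplify = solve 2 (λ k z → k :+ z :+ :- k := z) refl

  *-cancelʳ : ∀ {x y p} → p ≢ 0# → x * p ≡ y * p → x ≡ y
  *-cancelʳ {x} {y} {p} p≢0 eq = *-cancelˡ x y p≢0 (trans (*-comm p x) (trans eq (*-comm y p)))

  nonzero : Carrier → Bool
  nonzero x = not (does (x ≟ 0#))

  -- Multiplication by `a` permutes the nonzero elements, so `∏-differences-affine` relates their
  -- product to itself, and that product can be cancelled.
  fermat : ∀ {a} → a ≢ 0# → (q ∸ 1) ^^ a ≡ 1#
  fermat {a} a≢0 = *-cancelʳ (∏-differences-≢0 nonzero 0# nonzero-0) (begin
    (q ∸ 1) ^^ a * ∏-differences nonzero 0#          ≡⟨ cong (λ n → n ^^ a * ∏-differences nonzero 0#) count-nonzero ⟨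
    ((# nonzero of field-listing) ^^ a) * ∏-differences nonzero 0#
      ≡⟨ ∏-differences-affine nonzero nonzero 0# 0# a≢0 scaled ⟨
    ∏-differences nonzero 0#                         ≡⟨ *-identityˡ _ ⟨
    1# * ∏-differences nonzero 0#                    ∎)
    where
    open ≡-Reasoning
    nonzero-0 : nonzero 0# ≡ false
    nonzero-0 = cong not (dec-true (0# ≟ 0#) refl)
    count-nonzero : # nonzero of field-listing ≡ q ∸ 1
    count-nonzero = cong (_∸ 1) (trans (sym (count-remove _≟_ field-listing (λ _ → true) 0# refl)) count-field)
    simplify : ∀ x → 0# + a * (x + - 0#) ≡ a * x
    simplify x = trans (+-identityˡ _) (cong (a *_) (trans (cong (x +_) -0#≈0#) (+-identityʳ x)))
    scaled : ∀ x → nonzero x ≡ nonzero (0# + a * (x + - 0#))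
    scaled x with x ≟ 0#
    ... | yes x≡0 = sym (cong not (dec-true (_ ≟ _)
                      (trans (simplify x) (trans (cong (a *_) x≡0) (zeroʳ a)))))
    ... | no x≢0 = sym (cong not (dec-false (_ ≟ _)
                      (λ eq → *-≢0 a≢0 x≢0 (trans (sym (simplify x)) eq))))

  -- Comparing the products of x - m over u₁ and of y - k over u₂ gives a ^ n = b ^ n, where
  -- n counts u₁; since also (a / b) ^ (q - 1) = 1, coprimality leaves only a = b.
  affine-slope-unique : ∀ {a b} u₁ u₂ k m → a ≢ 0# → b ≢ 0# → u₁ m ≡ false →
    gcd (q ∸ 1) (# u₁ of field-listing) ≡ 1 →
    (∀ x → u₁ x ≡ u₂ (k + a * (x + - m))) → (∀ x → u₁ x ≡ u₂ (k + b * (x + - m))) → a ≡ b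
  affine-slope-unique {a} {b} u₁ u₂ k m a≢0 b≢0 u₁m≡false coprime via-a via-b =
    trans (sym z*b≡a) (trans (cong (_* b) z≡1) (*-identityˡ b))
    where
    n = # u₁ of field-listing
    z = a * b ⁻¹
    z*b≡a : z * b ≡ a
    z*b≡a = trans (*-assoc a (b ⁻¹) b) (trans (cong (a *_) (inverseˡ b b≢0)) (*-identityʳ a))
    powers-equal : n ^^ a ≡ n ^^ b
    powers-equal = *-cancelʳ (∏-differences-≢0 u₁ m u₁m≡false)
      (trans (sym (∏-differences-affine u₁ u₂ k m a≢0 via-a)) (∏-differences-affine u₁ u₂ k m b≢0 via-b))
    zⁿ≡1 : n ^^ z ≡ 1#
    zⁿ≡1 = *-cancelʳ (^^-≢0 n b≢0) (begin
      (n ^^ z) * (n ^^ b)  ≡⟨ Mul.×-distrib-+ z b n ⟨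
      n ^^ (z * b)         ≡⟨ cong (n ^^_) z*b≡a ⟩
      n ^^ a               ≡⟨ powers-equal ⟩
      n ^^ b               ≡⟨ *-identityˡ _ ⟨
      1# * (n ^^ b)        ∎)
      where open ≡-Reasoning
    z≡1 : z ≡ 1#
    z≡1 = Mul.coprime-order (q ∸ 1) n z coprime (fermat (*-≢0 a≢0 (⁻¹-≢0 b≢0))) zⁿ≡1

-- Tangent lines as a decidable property.

open Listing

true≢false : ∀ {b} → b ≡ true → b ≢ false
true≢false refl ()

not-true : ∀ {b} → not b ≡ true → b ≡ false
not-true = not-injective

maybe-listing : {A : Set} → Listing A → Listing (Maybe A)
maybe-listing as = record
  { list     = nothing ∷ map just (list as)
  ; unique   = All.tabulate (λ x∈ eq → case ∈-map⁻ just (subst (_∈ _) (sym eq) x∈) of λ { (_ , _ , ()) })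
               ∷ map⁺ (λ { refl → refl }) (unique as)
  ; complete = λ { nothing → here refl ; (just a) → there (∈-map⁺ just (complete as a)) }
  }

count-maybe : {A : Set} (as : Listing A) (p : Maybe A → Bool) → p nothing ≡ true →
  # p of (maybe-listing as) ≡ suc (# (p ∘ just) of as)
count-maybe as p p-nothing rewrite p-nothing = cong suc (go (list as))
  where
  go : ∀ xs → length (select p (map just xs)) ≡ length (select (p ∘ just) xs)
  go [] = refl
  go (x ∷ xs) with p (just x)
  ... | true  = cong suc (go xs)
  ... | false = go xs

find : {A : Set} (as : Listing A) (p : A → Bool) → (∃ λ a → p a ≡ true) ⊎ (∀ a → p a ≡ false)
find as p with select p (list as) in sel
... | a ∷ _ = inj₁ (a , ∈-select⁻ as p (subst (a ∈_) (sym sel) (here refl)))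
... | []    = inj₂ λ a → ¬-not λ pa → case subst (a ∈_) sel (∈-select⁺ as p pa) of λ ()

allB-true : {A : Set} (f : A → Bool) {xs : List A} → allB f xs ≡ true → ∀ {x} → x ∈ xs → f x ≡ true
allB-true f {y ∷ ys} all≡true (here refl) = proj₁ (∧-≡true all≡true)
allB-true f {y ∷ ys} all≡true (there x∈)  = allB-true f (proj₂ (∧-≡true {f y} all≡true)) x∈

allB-false : {A : Set} (f : A → Bool) (xs : List A) → allB f xs ≡ false → ∃ λ x → f x ≡ false
allB-false f (x ∷ xs) all≡false with f x in fx
... | true  = allB-false f xs all≡false
... | false = x , fx

module Tangents {q : ℕ} (F : FiniteField q) where
  open FiniteField F
  open PG2 F
  open Plane F

  ≟P-sound : ∀ P Q → (P ≟P Q) ≡ true → P ≡ Q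
  ≟P-sound (affine x y) (affine x' y') eq with x ≟ x' | y ≟ y' | eq
  ... | yes refl | yes refl | _ = refl
  ... | yes _    | no _     | ()
  ≟P-sound (infty x) (infty x') eq with x ≟ x' | eq
  ... | yes refl | _ = refl
  ≟P-sound vert vert _ = refl

  ≟P-refl : ∀ P → (P ≟P P) ≡ true
  ≟P-refl (affine x y) = cong₂ _∧_ (dec-true (x ≟ x) refl) (dec-true (y ≟ y) refl)
  ≟P-refl (infty x) = dec-true (x ≟ x) refl
  ≟P-refl vert = refl

  tangent-on : ∀ S P ℓ → isTangent S P ℓ ≡ true → on P ℓ ≡ true
  tangent-on S P ℓ tan = proj₁ (∧-≡true (proj₂ (∧-≡true {S P} tan)))

  private
    meetsOnlyAt : PointSet → Point → Line → Point → Bool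
    meetsOnlyAt S P ℓ Q = not (S Q ∧ on Q ℓ) ∨ (Q ≟P P)

    implication-false : ∀ {a b c} → not (a ∧ b) ∨ c ≡ false → a ≡ true × b ≡ true × c ≡ false
    implication-false {true} {true} c≡false = refl , refl , c≡false

  tangent-unique : ∀ S P ℓ → isTangent S P ℓ ≡ true → ∀ {Q} → S Q ≡ true → on Q ℓ ≡ true → Q ≡ P
  tangent-unique S P ℓ tan {Q} SQ onQ = ≟P-sound Q P
    (subst (λ b → not b ∨ (Q ≟P P) ≡ true) (cong₂ _∧_ SQ onQ)
      (allB-true (meetsOnlyAt S P ℓ) (proj₂ (∧-≡true {on P ℓ} (proj₂ (∧-≡true {S P} tan))))
        (complete point-listing Q)))

  nontangent-another : ∀ S P ℓ → isTangent S P ℓ ≡ false → S P ≡ true → on P ℓ ≡ true →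
    ∃ λ Q → S Q ≡ true × on Q ℓ ≡ true × Q ≢ P
  nontangent-another S P ℓ nontan SP onP
    with allB-false (meetsOnlyAt S P ℓ) allPoints
           (trans (sym (cong₂ (λ a b → a ∧ b ∧ allB (meetsOnlyAt S P ℓ) allPoints) SP onP)) nontan)
  ... | Q , eq with implication-false {S Q} {on Q ℓ} eq
  ... | SQ , onQ , Q≢P = Q , SQ , onQ ,
    λ Q≡P → true≢false (subst (λ R → (Q ≟P R) ≡ true) Q≡P (≟P-refl Q)) Q≢P

-- Semiarcs of the given type: tangents at the points of ℓ₁.

module VType {q : ℕ} (F : FiniteField q) (t : ℕ) (t<q∸1 : t < q ∸ 1) (S : PG2.PointSet F)
  (semiarc : ∀ P → S P ≡ true → PG2.numTangents F S P ≡ t)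
  (ℓ₁ ℓ₂ : PG2.Line F) (coordinatisation : Coordinates.Coordinatisation F ℓ₁ ℓ₂)
  (vertex∉S : ∀ P → PG2.on F P ℓ₁ ≡ true → PG2.on F P ℓ₂ ≡ true → S P ≡ false)
  (conf : PG2.IsVtConfWrt F t ℓ₁ ℓ₂ (PG2._∩_ F (PG2.symDiff F ℓ₁ ℓ₂) S)) where

  open FiniteField F
  open PG2 F
  open Coordinates F
  open FieldTheory F
  open Plane F
  open FieldSums F
  open Add using () renaming (_·_ to _⋆_; fold to ∑)
  open Tangents F
  open Coordinatisation coordinatisation
  open CommutativeRing commutativeRing using
    (+-comm; +-identityˡ; +-identityʳ; zeroˡ; zeroʳ; -‿inverseˡ; ring)
  open import Algebra.Properties.Ring ring using (-0#≈0#; -‿involutive; -‿injective)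
  open RingSolver commutativeRing using (solve; _:=_; _:+_; _:*_; :-_)

  -- Slopes index the points of ℓ₁, intercepts those of ℓ₂. The common point `point vert` has no
  -- index, so each line contributes exactly `q` points.
  s₁ t₁ s₂ t₂ : Carrier → Bool
  s₁ m = S (point (infty m))
  s₂ k = S (point (affine 0# k))
  t₁ m = not (s₁ m)
  t₂ k = not (s₂ k)

  on-line : ∀ {P L ℓ} → line L ≡ ℓ → Inc P L → on (point P) ℓ ≡ true
  on-line {P} {L} L≡ℓ inc = subst (λ ℓ → on (point P) ℓ ≡ true) L≡ℓ (Inc⇒on P L inc)

  on-line⁻ : ∀ {P L ℓ} → line L ≡ ℓ → on (point P) ℓ ≡ true → Inc P L
  on-line⁻ {P} {L} L≡ℓ onP = on⇒Inc P L (subst (λ ℓ → on (point P) ℓ ≡ true) (sym L≡ℓ) onP)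

  off-line : ∀ {P L ℓ} → line L ≡ ℓ → ¬ Inc P L → on (point P) ℓ ≡ false
  off-line L≡ℓ ¬inc = ¬-not (¬inc ∘ on-line⁻ L≡ℓ)

  infty0-inc : ∀ {b c} → b ≡ 0# → Inc (affine b c) (infty 0#)
  infty0-inc b≡0 = trans (+-identityˡ _) b≡0

  infty0-inc⁻ : ∀ {b c} → Inc (affine b c) (infty 0#) → b ≡ 0#
  infty0-inc⁻ inc = trans (sym (+-identityˡ _)) inc

  vertex∉ : S (point vert) ≡ false
  vertex∉ = vertex∉S (point vert) (on-line line-vert tt) (on-line line-infty0 tt)

  private
    missing : Bool → Bool → Bool → Bool
    missing on₁ on₂ s = on₁ ∧ not on₂ ∧ not (((on₁ ∧ not on₂) ∨ (on₂ ∧ not on₁)) ∧ s)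

    missing′ : Bool → Bool → Bool → Bool
    missing′ on₁ on₂ s = on₂ ∧ not on₁ ∧ not (((on₁ ∧ not on₂) ∨ (on₂ ∧ not on₁)) ∧ s)

  count-t₁ : # t₁ of field-listing ≡ t
  count-t₁ = trans
    (count-image field-listing point-listing (λ m → point (infty m)) (infty-injective ∘ point-injective)
      t₁ (λ P → missing (on P ℓ₁) (on P ℓ₂) (S P)) pointwise onto)
    (proj₁ (proj₂ (proj₂ conf)))
    where
    pointwise : ∀ m → t₁ m ≡ missing (on (point (infty m)) ℓ₁) (on (point (infty m)) ℓ₂) (s₁ m)
    pointwise m = sym (cong₂ (λ a b → missing a b (s₁ m))
      (on-line line-vert tt) (off-line {infty m} line-infty0 (λ ())))
    onto : ∀ P → missing (on P ℓ₁) (on P ℓ₂) (S P) ≡ true → ∃ λ m → P ≡ point (infty m)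
    onto P eq with point-surjective P
    ... | affine b c , refl = case on-line⁻ {affine b c} line-vert (proj₁ (∧-≡true eq)) of λ ()
    ... | infty m    , refl = m , refl
    ... | vert       , refl = contradiction
      (not-true (proj₁ (∧-≡true (proj₂ (∧-≡true {on (point vert) ℓ₁} eq)))))
      (true≢false (on-line line-infty0 tt))

  count-t₂ : # t₂ of field-listing ≡ t
  count-t₂ = trans
    (count-image field-listing point-listing (λ k → point (affine 0# k))
      (λ eq → proj₂ (affine-injective (point-injective eq)))
      t₂ (λ P → missing′ (on P ℓ₁) (on P ℓ₂) (S P)) pointwise onto)
    (proj₂ (proj₂ (proj₂ conf)))
    where
    pointwise : ∀ k → t₂ k ≡ missing′ (on (point (affine 0# k)) ℓ₁) (on (point (affine 0# k)) ℓ₂) (s₂ k)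
    pointwise k = sym (cong₂ (λ a b → missing′ a b (s₂ k))
      (off-line {affine 0# k} line-vert (λ ())) (on-line line-infty0 (infty0-inc {c = k} refl)))
    onto : ∀ P → missing′ (on P ℓ₁) (on P ℓ₂) (S P) ≡ true → ∃ λ k → P ≡ point (affine 0# k)
    onto P eq with point-surjective P
    ... | affine b c , refl = c , cong (λ b → point (affine b c))
      (infty0-inc⁻ {c = c} (on-line⁻ {affine b c} line-infty0 (proj₁ (∧-≡true eq))))
    ... | infty m    , refl = case on-line⁻ {infty m} line-infty0 (proj₁ (∧-≡true eq)) of λ ()
    ... | vert       , refl = contradiction
      (not-true (proj₁ (∧-≡true (proj₂ (∧-≡true {on (point vert) ℓ₂} eq)))))
      (true≢false (on-line line-vert tt))

  -- S contains `q - t` points of ℓ₁, and `t < q ∸ 1` makes these at least two; a single one would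
  -- give `suc t ≡ q`. Its purpose is to show that ℓ₁ is not a tangent.
  another-s₁ : ∀ m → s₁ m ≡ true → ∃ λ m' → s₁ m' ≡ true × m' ≢ m
  another-s₁ m s₁m with count≢0⇒∃ field-listing (λ x → s₁ x ∧ not (does (x ≟ m))) (λ others≡0 →
      ℕₚ.<-irrefl (cong (_∸ 1) (begin
        suc t                                    ≡⟨ cong₂ ℕ._+_ (cong suc (sym others≡0)) (sym count-t₁) ⟩
        suc (# (λ x → s₁ x ∧ not (does (x ≟ m))) of field-listing) ℕ.+ (# t₁ of field-listing)
          ≡⟨ cong (ℕ._+ (# t₁ of field-listing)) (count-remove _≟_ field-listing s₁ m s₁m) ⟨
        (# s₁ of field-listing) ℕ.+ (# t₁ of field-listing)
          ≡⟨ count-split field-listing (λ _ → true) s₁ ⟨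
        # (λ _ → true) of field-listing          ≡⟨ count-field ⟩
        q                                        ∎)) t<q∸1)
    where open ≡-Reasoning
  ... | m' , eq = m' , proj₁ (∧-≡true eq) , λ m'≡m →
    true≢false (proj₂ (∧-≡true {s₁ m'} eq)) (cong not (dec-true (m' ≟ m) m'≡m))

  -- A line joining the point to a point of S on ℓ₂ is not a tangent, and neither is ℓ₁. The `t`
  -- tangents are therefore among the `t` lines to missing points of ℓ₂, and equality of the counts
  -- makes all of these tangents.
  t₂-tangent : ∀ {m} → s₁ m ≡ true → ∀ k → t₂ k ≡ isTangent S (point (infty m)) (line (affine m k))
  t₂-tangent {m} s₁m = ⇒∧count≡⇒≗ field-listing t₂ tangent tangent⇒t₂ (trans count-t₂ (sym count-tangents))
    where
    P = point (infty m)
    tangent : Carrier → Bool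
    tangent k = isTangent S P (line (affine m k))
    tangent⇒t₂ : ∀ k → tangent k ≡ true → t₂ k ≡ true
    tangent⇒t₂ k tan = cong not (¬-not λ s₂k → case point-injective
      (tangent-unique S P (line (affine m k)) tan s₂k (Inc⇒on (affine 0# k) (affine m k)
        (sym (trans (cong (_+ k) (zeroʳ m)) (+-identityˡ k))))) of λ ())
    count-tangents : # tangent of field-listing ≡ t
    count-tangents = trans
      (count-image field-listing point-listing (λ k → line (affine m k))
        (λ eq → proj₂ (affine-injective (line-injective eq))) tangent (isTangent S P) (λ _ → refl) onto)
      (semiarc P s₁m)
      where
      onto : ∀ ℓ → isTangent S P ℓ ≡ true → ∃ λ k → ℓ ≡ line (affine m k)
      onto ℓ tan with line-surjective ℓ
      ... | affine m' k , refl = k , cong (λ m → line (affine m k))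
        (sym (on⇒Inc (infty m) (affine m' k) (tangent-on S P (line (affine m' k)) tan)))
      ... | infty k     , refl = case on⇒Inc (infty m) (infty k) (tangent-on S P (line (infty k)) tan) of λ ()
      ... | vert        , refl with another-s₁ m s₁m
      ...   | m' , s₁m' , m'≢m = contradiction
        (infty-injective (point-injective (tangent-unique S P (line vert) tan s₁m' (Inc⇒on (infty m') vert tt)))) m'≢m

  -- Projection of ℓ₁ onto ℓ₂ from an external point.

  External : Carrier → Carrier → Set
  External b c = b ≢ 0# × S (point (affine b c)) ≡ true

  project : Carrier → Carrier → Carrier → Carrier
  project b c m = c + - (m * b)

  on-project : ∀ b c m → Inc (affine b c) (affine m (project b c m))
  on-project b c m = solve 3 (λ b c m → c := m :* b :+ (c :+ :- (m :* b))) refl b c m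

  -- Rebases the projection at a line through its centre: all centres on `y = m x + k` send `m` to
  -- `k`, so their projections differ only in the multiplier `- b`.
  project≡ : ∀ {b c m k} → c ≡ m * b + k → ∀ x → project b c x ≡ k + - b * (x + - m)
  project≡ {b} {m = m} {k} refl x =
    solve 4 (λ b m k x → (m :* b :+ k) :+ :- (x :* b) := k :+ (:- b) :* (x :+ :- m)) refl b m k x

  -b≢0 : ∀ {b} → b ≢ 0# → - b ≢ 0#
  -b≢0 {b} b≢0 -b≡0 = b≢0 (trans (sym (-‿involutive b)) (trans (cong -_ -b≡0) -0#≈0#))

  private
    through-y-axis : ∀ {b} c → c ≡ 0# * b + c
    through-y-axis {b} c = sym (trans (cong (_+ c) (zeroˡ b)) (+-identityˡ c))

  project-injective : ∀ {b} c → b ≢ 0# → ∀ {x y} → project b c x ≡ project b c y → x ≡ y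
  project-injective c b≢0 {x} {y} eq = affine-map-injective c 0# (-b≢0 b≢0)
    (trans (sym (project≡ (through-y-axis c) x)) (trans eq (project≡ (through-y-axis c) y)))

  project-surjective : ∀ {b} c → b ≢ 0# → ∀ k → ∃ λ m → k ≡ project b c m
  project-surjective c b≢0 k with affine-map-surjective c 0# (-b≢0 b≢0) k
  ... | m , eq = m , trans eq (sym (project≡ (through-y-axis c) m))

  module _ {b c} (ext : External b c) where

    -- If a point of S on ℓ₁ were projected to a missing point of ℓ₂, the line used would be a
    -- tangent by `t₂-tangent`, yet it contains the external point. So the preimage of `t₂` lies in
    -- `t₁`, and both have `t` elements.
    t₁-project : ∀ m → t₁ m ≡ t₂ (project b c m)
    t₁-project = ⇒∧count≡⇒≗ field-listing t₁ (t₂ ∘ project b c) t₂⇒t₁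
      (trans count-t₁ (trans (sym count-t₂) (sym (count-image field-listing field-listing (project b c)
        (project-injective c (proj₁ ext)) (t₂ ∘ project b c) t₂ (λ _ → refl)
        (λ k _ → project-surjective c (proj₁ ext) k)))))
      where
      t₂⇒t₁ : ∀ m → t₂ (project b c m) ≡ true → t₁ m ≡ true
      t₂⇒t₁ m t₂φ = cong not (¬-not λ s₁m → case point-injective
        (tangent-unique S (point (infty m)) (line (affine m (project b c m)))
          (trans (sym (t₂-tangent s₁m (project b c m))) t₂φ) (proj₂ ext)
          (Inc⇒on (affine b c) (affine m (project b c m)) (on-project b c m))) of λ ())

  -- Secants through an external point.

  through : Carrier → Carrier → Maybe Carrier → Point
  through b c nothing  = infty (- b)
  through b c (just m) = affine m (project b c m)

  through-injective : ∀ {b c i j} → through b c i ≡ through b c j → i ≡ j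
  through-injective {i = nothing} {nothing} _  = refl
  through-injective {i = just m}  {just m'} eq = cong just (proj₁ (affine-injective eq))

  through-inc : ∀ b c i → Inc (affine b c) (through b c i)
  through-inc b c nothing  = -‿inverseˡ b
  through-inc b c (just m) = on-project b c m

  through-surjective : ∀ b c L → Inc (affine b c) L → ∃ λ i → L ≡ through b c i
  through-surjective b c (affine m k) inc = just m , cong (affine m) (sym (trans (cong (_+ - (m * b)) inc)
    (solve 3 (λ m b k → (m :* b :+ k) :+ :- (m :* b) := k) refl m b k)))
  through-surjective b c (infty k) inc = nothing , cong infty
    (x-y≡0⇒x≡y k (- b) (trans (cong (k +_) (-‿involutive b)) inc))

  -- The vertical line `nothing` meets ℓ₁ in the vertex, which is never in S, so it always counts.
  -- It is the one line by which these outnumber the tangents.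
  avoiding : Maybe Carrier → Bool
  avoiding nothing  = true
  avoiding (just m) = t₁ m

  Another : Carrier → Carrier → Maybe Carrier → Set
  Another b c i = ∃ λ b' → ∃ λ c' →
    External b' c' × affine b' c' ≢ affine b c × Inc (affine b' c') (through b c i)

  -- Of the t + 1 lines through an external point that miss S on ℓ₁, exactly t are tangents,
  -- so a unique one carries further points of S.
  unique-secant : ∀ {b c} → External b c →
    ∃ λ i → avoiding i ≡ true × Another b c i × (∀ j → avoiding j ≡ true → Another b c j → j ≡ i)
  unique-secant {b} {c} ext@(b≢0 , SR)
    with count-suc-difference (maybe-listing field-listing) avoiding tangent tangent⇒avoiding
           (trans (count-maybe field-listing avoiding refl) (cong suc (trans count-t₁ (sym count-tangents))))
    where
    R = point (affine b c)
    tangent : Maybe Carrier → Bool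
    tangent i = isTangent S R (line (through b c i))
    tangent⇒avoiding : ∀ i → tangent i ≡ true → avoiding i ≡ true
    tangent⇒avoiding nothing  tan = refl
    tangent⇒avoiding (just m) tan = cong not (¬-not λ s₁m → case point-injective
      (tangent-unique S R (line (through b c (just m))) tan s₁m
        (Inc⇒on (infty m) (through b c (just m)) refl)) of λ ())
    count-tangents : # tangent of (maybe-listing field-listing) ≡ t
    count-tangents = trans
      (count-image (maybe-listing field-listing) point-listing (λ i → line (through b c i))
        (through-injective ∘ line-injective) tangent (isTangent S R) (λ _ → refl) onto)
      (semiarc R SR)
      where
      onto : ∀ ℓ → isTangent S R ℓ ≡ true → ∃ λ i → ℓ ≡ line (through b c i)
      onto ℓ tan with line-surjective ℓ
      ... | L , refl with through-surjective b c L (on⇒Inc (affine b c) L (tangent-on S R (line L) tan))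
      ...   | i , L≡ = i , cong line L≡
  ... | i , avoiding-i , nontangent-i , unique-i =
    i , avoiding-i , another , λ j avoiding-j another-j → unique-i j avoiding-j (nontangent j another-j)
    where
    R = point (affine b c)
    nontangent : ∀ j → Another b c j → isTangent S R (line (through b c j)) ≡ false
    nontangent j (b' , c' , ext' , R'≢R , inc) = ¬-not λ tan → R'≢R (point-injective
      (tangent-unique S R (line (through b c j)) tan (proj₂ ext') (Inc⇒on (affine b' c') (through b c j) inc)))
    -- The projection maps `t₁` into `t₂`, so a line that misses S on ℓ₁ also misses it on ℓ₂. Hence
    -- the second point of S on the secant is again external.
    s₂-avoiding : ∀ i → avoiding i ≡ true → ∀ c' → s₂ c' ≡ true → ¬ Inc (affine 0# c') (through b c i)
    s₂-avoiding nothing  _   c' s₂c' inc = -b≢0 b≢0 (trans (sym (+-identityʳ (- b))) inc)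
    s₂-avoiding (just m) t₁m c' s₂c' inc = true≢false s₂c'
      (not-true (trans (cong t₂ (trans inc (trans (cong (_+ project b c m) (zeroʳ m)) (+-identityˡ _))))
        (trans (sym (t₁-project ext m)) t₁m)))
    another : Another b c i
    another with nontangent-another S R (line (through b c i)) nontangent-i SR
                   (Inc⇒on (affine b c) (through b c i) (through-inc b c i))
    ... | Q , SQ , onQ , Q≢R with point-surjective Q
    ... | vert , refl = contradiction vertex∉ (true≢false SQ)
    ... | infty m , refl = ⊥-elim (on-ideal i avoiding-i (on⇒Inc (infty m) (through b c i) onQ))
      where
      on-ideal : ∀ i → avoiding i ≡ true → ¬ Inc (infty m) (through b c i)
      on-ideal (just m') t₁m' refl = true≢false SQ (not-true t₁m')
    ... | affine b' c' , refl with b' ≟ 0#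
    ...   | yes refl = ⊥-elim (s₂-avoiding i avoiding-i c' SQ (on⇒Inc (affine 0# c') (through b c i) onQ))
    ...   | no b'≢0 = b' , c' , (b'≢0 , SQ) , (Q≢R ∘ cong point) ,
              on⇒Inc (affine b' c') (through b c i) onQ

  -- From a line through all external points to the conclusions.

  external? : (∃ λ b → ∃ λ c → External b c) ⊎ (∀ b c → ¬ External b c)
  external? with find point-listing external
    where
    external : Point → Bool
    external (affine b c) = nonzero b ∧ S (point (affine b c))
    external (infty _)    = false
    external vert         = false
  ... | inj₁ (affine b c , eq) = inj₁ (b , c ,
    (λ b≡0 → true≢false (proj₁ (∧-≡true eq)) (cong not (dec-true (b ≟ 0#) b≡0))) , proj₂ (∧-≡true {nonzero b} eq))
  ... | inj₂ none = inj₂ λ b c (b≢0 , SR) → true≢false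
    (cong₂ _∧_ (cong not (dec-false (b ≟ 0#) b≢0)) SR) (none (affine b c))

  IsVtConf-of-no-external : (∀ b c → ¬ External b c) → IsVtConf t S
  IsVtConf-of-no-external none = ℓ₁ , ℓ₂ , proj₁ conf , S⊆ ,
    trans (count-cong point-listing (λ P → outside (on P ℓ₁) (on P ℓ₂) (S P))) (proj₁ (proj₂ (proj₂ conf))) ,
    trans (count-cong point-listing (λ P → outside′ (on P ℓ₁) (on P ℓ₂) (S P))) (proj₂ (proj₂ (proj₂ conf)))
    where
    outside : ∀ x y s → x ∧ not y ∧ not s ≡ missing x y s
    outside true  true  s = refl
    outside true  false s = refl
    outside false y     s = refl
    outside′ : ∀ x y s → y ∧ not x ∧ not s ≡ missing′ x y s
    outside′ true  true  s = refl
    outside′ false true  s = refl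
    outside′ true  false s = refl
    outside′ false false s = refl
    S⊆ : S ⊆ symDiff ℓ₁ ℓ₂
    S⊆ Q SQ with point-surjective Q
    ... | vert , refl = contradiction vertex∉ (true≢false SQ)
    ... | infty m , refl = cong₂ (λ x y → (x ∧ not y) ∨ (y ∧ not x))
      (on-line line-vert tt) (off-line {infty m} line-infty0 (λ ()))
    ... | affine b c , refl with b ≟ 0#
    ...   | yes b≡0 = cong₂ (λ x y → (x ∧ not y) ∨ (y ∧ not x))
              (off-line {affine b c} line-vert (λ ())) (on-line line-infty0 (infty0-inc {b} {c} b≡0))
    ...   | no b≢0 = contradiction (b≢0 , SQ) (none b c)

  -- The conditions on `m` and `k` say that the third line meets ℓ₁ and ℓ₂ outside S, as the removal
  -- of these vertices demands.
  triangle : ∀ m k → t₁ m ≡ true → t₂ k ≡ true → (∀ {b c} → External b c → c ≡ m * b + k) →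
    InVertexlessTriangle S
  triangle m k t₁m t₂k collinear = ℓ₁ , ℓ₂ , line (affine m k) , nonconcurrent , contained
    where
    nonconcurrent : NonConcurrent ℓ₁ ℓ₂ (line (affine m k))
    nonconcurrent Q eq with point-surjective Q
    ... | P , refl with ∧-≡true {on (point P) ℓ₁} eq
    ... | on₁ , eq' with ∧-≡true {on (point P) ℓ₂} eq'
    ... | on₂ , on₃ = go P (on-line⁻ line-vert on₁) (on-line⁻ line-infty0 on₂) (on⇒Inc P (affine m k) on₃)
      where
      go : ∀ P → Inc P vert → Inc P (infty 0#) → ¬ Inc P (affine m k)
      go vert _ _ ()

    contained : S ⊆ vertexlessTriangle ℓ₁ ℓ₂ (line (affine m k))
    contained Q SQ with point-surjective Q
    ... | vert , refl = contradiction vertex∉ (true≢false SQ)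
    ... | infty x , refl
      rewrite on-line {infty x} line-vert tt | off-line {infty x} line-infty0 (λ ())
            | off-line {infty x} {affine m k} refl (λ { refl → true≢false SQ (not-true t₁m) }) = refl
    ... | affine b c , refl with b ≟ 0#
    ...   | yes refl
      rewrite off-line {affine 0# c} line-vert (λ ()) | on-line {affine 0# c} line-infty0 (infty0-inc {c = c} refl)
            | off-line {affine 0# c} {affine m k} refl (λ c≡ → true≢false SQ (trans
                (cong s₂ (trans c≡ (trans (cong (_+ k) (zeroʳ m)) (+-identityˡ k)))) (not-true t₂k))) = refl
    ...   | no b≢0
      rewrite off-line {affine b c} line-vert (λ ()) | off-line {affine b c} line-infty0 (b≢0 ∘ infty0-inc⁻ {c = c})
            | on-line {affine b c} {affine m k} refl (collinear (b≢0 , SQ)) = refl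

  -- The lines `infty e` are those through the vertex other than ℓ₁; `e ≢ 0#` keeps the third line
  -- apart from ℓ₂.
  concurrent : ∀ e → e ≢ 0# → (∀ {b c} → External b c → Inc (affine b c) (infty e)) → InConcurrentTriple S
  concurrent e e≢0 vertical = point vert , ℓ₁ , ℓ₂ , line (infty e) , proj₁ conf ,
    (λ eq → case line-injective (trans line-vert eq) of λ ()) ,
    (λ eq → e≢0 (sym (infty-injective (line-injective (trans line-infty0 eq))))) ,
    on-line line-vert tt , on-line line-infty0 tt , on-line {vert} {infty e} refl tt , contained
    where
    not-vertex : ∀ {P} → P ≢ vert → (point P ≟P point vert) ≡ false
    not-vertex {P} P≢vert = ¬-not (P≢vert ∘ point-injective ∘ ≟P-sound (point P) (point vert))
    contained : S ⊆ concurrentTriple (point vert) ℓ₁ ℓ₂ (line (infty e))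
    contained Q SQ with point-surjective Q
    ... | vert , refl = contradiction vertex∉ (true≢false SQ)
    ... | infty x , refl
      rewrite on-line {infty x} line-vert tt | not-vertex {infty x} (λ ()) = refl
    ... | affine b c , refl with b ≟ 0#
    ...   | yes refl
      rewrite off-line {affine 0# c} line-vert (λ ()) | on-line {affine 0# c} line-infty0 (infty0-inc {c = c} refl)
            | not-vertex {affine 0# c} (λ ()) = refl
    ...   | no b≢0
      rewrite off-line {affine b c} line-vert (λ ()) | off-line {affine b c} line-infty0 (b≢0 ∘ infty0-inc⁻ {c = c})
            | on-line {affine b c} {infty e} refl (vertical (b≢0 , SQ)) | not-vertex {affine b c} (λ ()) = refl

  -- Both lines pass through both points, so eliminating the intercepts leaves
  -- `(b' + - b) * (m + - n) ≡ 0#`.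
  slope-unique : ∀ {b c b' c' m k n} → b' ≢ b → c ≡ n * b + k → c' ≡ n * b' + k →
    Inc (affine b' c') (through b c (just m)) → m ≡ n
  slope-unique {b} {c} {b'} {c'} {m} {k} {n} b'≢b refl refl inc = x-y≡0⇒x≡y m n
    (*-cancelˡ-0 (b'≢b ∘ x-y≡0⇒x≡y b' b) (begin
      (b' + - b) * (m + - n)                                     ≡⟨ expand b b' m k n ⟩
      (m * b' + ((n * b + k) + - (m * b))) + - (n * b' + k)      ≡⟨ x≡y⇒x-y≡0 (sym inc) ⟩
      0#                                                         ∎))
    where
    open ≡-Reasoning
    expand : ∀ b b' m k n →
      (b' + - b) * (m + - n) ≡ (m * b' + ((n * b + k) + - (m * b))) + - (n * b' + k)
    expand = solve 5 (λ b b' m k n → (b' :+ :- b) :* (m :+ :- n) :=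
      (m :* b' :+ ((n :* b :+ k) :+ :- (m :* b))) :+ :- (n :* b' :+ k)) refl

  -- The case of t nonzero in the field.

  module CharacteristicCoprime (t·1≢0 : t ⋆ 1# ≢ 0#) where

    private
      σ₁ σ₂ τ : Carrier
      σ₁ = ∑ (select t₁ elements)
      σ₂ = ∑ (select t₂ elements)
      τ = t ⋆ 1#

    m₀ k₀ : Carrier
    m₀ = τ ⁻¹ * σ₁
    k₀ = τ ⁻¹ * σ₂

    -- Projection from an external point carries t₁ to t₂, hence the barycentre m₀ to k₀.
    collinear : ∀ {b c} → External b c → c ≡ m₀ * b + k₀
    collinear {b} {c} ext = *-cancelˡ c (m₀ * b + k₀) t·1≢0 (begin
      τ * c                            ≡⟨ solve 2 (λ x y → x := (x :+ :- y) :+ y) refl (τ * c) (σ₁ * b) ⟩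
      (τ * c + - (σ₁ * b)) + σ₁ * b    ≡⟨ cong (_+ σ₁ * b) sums ⟨
      σ₂ + σ₁ * b                      ≡⟨ cong₂ (λ x y → x + y * b) (x*[x⁻¹*y]≡y σ₂ t·1≢0) (x*[x⁻¹*y]≡y σ₁ t·1≢0) ⟨
      τ * k₀ + τ * m₀ * b              ≡⟨ factor τ k₀ m₀ b ⟩
      τ * (m₀ * b + k₀)                ∎)
      where
      open ≡-Reasoning
      xs = select t₁ elements
      factor : ∀ τ k m b → τ * k + τ * m * b ≡ τ * (m * b + k)
      factor = solve 4 (λ τ k m b → τ :* k :+ τ :* m :* b := τ :* (m :* b :+ k)) refl
      neg* : ∀ x → - (x * b) ≡ x * - b
      neg* x = solve 2 (λ x b → :- (x :* b) := x :* (:- b)) refl x b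
      sums : σ₂ ≡ τ * c + - (σ₁ * b)
      sums = begin
        σ₂
          ≡⟨ Add.fold-↭ (select-image-↭ field-listing field-listing (project b c)
               (project-injective c (proj₁ ext)) t₁ t₂ (t₁-project ext)
               (λ k _ → project-surjective c (proj₁ ext) k)) ⟨
        ∑ (map (project b c) xs)
          ≡⟨ cong ∑ (map-cong (λ x → cong (c +_) (neg* x)) xs) ⟩
        ∑ (map (λ x → c + x * - b) xs)
          ≡⟨ Add.fold-map-∙ (λ _ → c) (_* - b) xs ⟩
        ∑ (map (λ _ → c) xs) + ∑ (map (_* - b) xs)
          ≡⟨ cong₂ _+_ (Add.fold-const c xs) (∑-*ʳ (- b) xs) ⟩
        length xs ⋆ c + σ₁ * - b
          ≡⟨ cong₂ _+_ (trans (cong (_⋆ c) count-t₁) (⋆≡⋆1* t c)) (sym (neg* σ₁)) ⟩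
        τ * c + - (σ₁ * b)  ∎

    -- The secant from `unique-secant` contains two external points, which lie on `y = m₀ x + k₀` by
    -- `collinear`; so it is that line, and its slope `m₀` is missing from S. A vertical secant is
    -- excluded because `collinear` gives distinct external points distinct abscissae.
    companion : ∀ {b c} → External b c →
      t₁ m₀ ≡ true × ∃ λ b' → ∃ λ c' → External b' c' × b' ≢ b
    companion {b} {c} ext = go (unique-secant ext)
      where
      go : (∃ λ i → avoiding i ≡ true × Another b c i × _) →
        t₁ m₀ ≡ true × ∃ λ b' → ∃ λ c' → External b' c' × b' ≢ b
      go (i , avoiding-i , (b' , c' , ext' , R'≢R , inc) , _) =
        on-axis i avoiding-i inc , b' , c' , ext' , b'≢b
        where
        b'≢b : b' ≢ b
        b'≢b b'≡b = R'≢R (cong₂ affine b'≡b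
          (trans (collinear ext') (trans (cong (λ b → m₀ * b + k₀) b'≡b) (sym (collinear ext)))))
        on-axis : ∀ i → avoiding i ≡ true → Inc (affine b' c') (through b c i) → t₁ m₀ ≡ true
        on-axis nothing  _   inc = contradiction (x-y≡0⇒x≡y b' b (trans (+-comm b' (- b)) inc)) b'≢b
        on-axis (just m) t₁m inc = subst (λ m → t₁ m ≡ true)
          (slope-unique b'≢b (collinear ext) (collinear ext') inc) t₁m

    t₂k₀ : ∀ {b c} → External b c → t₂ k₀ ≡ true
    t₂k₀ {b} {c} ext = trans (cong t₂ (sym (trans (cong (_+ - (m₀ * b)) (collinear ext))
      (solve 2 (λ x k → x :+ k :+ :- x := k) refl (m₀ * b) k₀))))
      (trans (sym (t₁-project ext m₀)) (proj₁ (companion ext)))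

    t≢0 : t ≢ 0
    t≢0 refl = t·1≢0 refl

    in-triangle : InVertexlessTriangle S
    in-triangle = go external?
      where
      go : (∃ λ b → ∃ λ c → External b c) ⊎ (∀ b c → ¬ External b c) → InVertexlessTriangle S
      go (inj₁ (b , c , ext)) = triangle m₀ k₀ (proj₁ (companion ext)) (t₂k₀ ext) collinear
      -- Any line joining a missing point of ℓ₁ to one of ℓ₂ serves as third side; such points exist
      -- because `t` is not 0.
      go (inj₂ none) = triangle (proj₁ m) (proj₁ k) (proj₂ m) (proj₂ k) λ ext → contradiction ext (none _ _)
        where
        m = count≢0⇒∃ field-listing t₁ (λ #t₁≡0 → t≢0 (trans (sym count-t₁) #t₁≡0))
        k = count≢0⇒∃ field-listing t₂ (λ #t₂≡0 → t≢0 (trans (sym count-t₂) #t₂≡0))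

    -- As `m₀` lies in `t₁`, it would contribute a zero factor to the product. Deleting it from
    -- `t₁`, and its image `k₀` from `t₂`, leaves sets of size `t ∸ 1` to which
    -- `affine-slope-unique` applies; two external points would then share their abscissa.
    no-external : gcd (q ∸ 1) (t ∸ 1) ≡ 1 → ∀ b c → ¬ External b c
    no-external coprime b c ext = go (companion ext)
      where
      u₁ u₂ : Carrier → Bool
      u₁ x = t₁ x ∧ not (does (x ≟ m₀))
      u₂ y = t₂ y ∧ not (does (y ≟ k₀))
      transport : ∀ {b c} → External b c → ∀ x → u₁ x ≡ u₂ (k₀ + - b * (x + - m₀))
      transport {b} ext x = cong₂ (λ x y → x ∧ not y)
        (trans (t₁-project ext x) (cong t₂ (project≡ (collinear ext) x)))
        (affine-map-fixed k₀ m₀ (-b≢0 (proj₁ ext)) x)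
      go : ¬ (t₁ m₀ ≡ true × ∃ λ b' → ∃ λ c' → External b' c' × b' ≢ b)
      go (t₁m₀ , b' , c' , ext' , b'≢b) = b'≢b (-‿injective
        (affine-slope-unique u₁ u₂ k₀ m₀ (-b≢0 (proj₁ ext')) (-b≢0 (proj₁ ext)) u₁m₀≡false
          (trans (cong (gcd (q ∸ 1)) count-u₁) coprime) (transport ext') (transport ext)))
        where
        u₁m₀≡false : u₁ m₀ ≡ false
        u₁m₀≡false = cong₂ (λ x y → x ∧ not y) t₁m₀ (dec-true (m₀ ≟ m₀) refl)
        count-u₁ : # u₁ of field-listing ≡ t ∸ 1
        count-u₁ = cong (_∸ 1) (trans (sym (count-remove _≟_ field-listing t₁ m₀ t₁m₀)) count-t₁)

  -- The case of t coprime to q - 1.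

  module OrderCoprime (coprime : gcd (q ∸ 1) t ≡ 1) where

    -- The projections from two external points on a line of slope m agree at m, so if m were
    -- not in t₁, affine-slope-unique would make them equal.
    secant-avoiding : ∀ {b c b' c'} → External b c → External b' c' → b' ≢ b →
      ∀ m → Inc (affine b' c') (through b c (just m)) → t₁ m ≡ true
    secant-avoiding {b} {c} {b'} {c'} ext ext' b'≢b m inc = cong not (¬-not λ s₁m → b'≢b (-‿injective
      (affine-slope-unique t₁ t₂ (project b c m) m (-b≢0 (proj₁ ext')) (-b≢0 (proj₁ ext)) (cong not s₁m)
        (trans (cong (gcd (q ∸ 1)) count-t₁) coprime)
        (λ x → trans (t₁-project ext' x) (cong t₂ (project≡ inc x)))
        (λ x → trans (t₁-project ext x) (cong t₂ (project≡ (on-project b c m) x))))))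

    -- Puts the line from the first point to an arbitrary second external point in the form that the
    -- uniqueness clause of `unique-secant` accepts. A vertical join avoids S on ℓ₁ automatically,
    -- any other by `secant-avoiding`.
    join : ∀ {b c} → External b c → ∀ {b' c'} → External b' c' → affine b' c' ≢ affine b c →
      ∃ λ i → avoiding i ≡ true × Another b c i × Inc (affine b' c') (through b c i)
    join {b} {c} ext {b'} {c'} ext' R'≢R with b' ≟ b
    ... | yes b'≡b = nothing , refl , (b' , c' , ext' , R'≢R , inc) , inc
      where
      inc : - b + b' ≡ 0#
      inc = trans (+-comm (- b) b') (x≡y⇒x-y≡0 b'≡b)
    ... | no b'≢b = just m , secant-avoiding ext ext' b'≢b m inc , (b' , c' , ext' , R'≢R , inc) , inc
      where
      d≢0 : b' + - b ≢ 0#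
      d≢0 = b'≢b ∘ x-y≡0⇒x≡y b' b
      m = (b' + - b) ⁻¹ * (c' + - c)
      inc : c' ≡ m * b' + project b c m
      inc = sym (begin
        m * b' + (c + - (m * b))
          ≡⟨ solve 4 (λ m b b' c →
               m :* b' :+ (c :+ :- (m :* b)) := c :+ (b' :+ :- b) :* m) refl m b b' c ⟩
        c + (b' + - b) * m         ≡⟨ cong (c +_) (x*[x⁻¹*y]≡y (c' + - c) d≢0) ⟩
        c + (c' + - c)             ≡⟨ solve 2 (λ c c' → c :+ (c' :+ :- c) := c') refl c c' ⟩
        c'                         ∎)
        where open ≡-Reasoning

    in-triangle-or-concurrent : InVertexlessTriangle S ⊎ InConcurrentTriple S
    in-triangle-or-concurrent = go external?
      where
      go : (∃ λ b → ∃ λ c → External b c) ⊎ (∀ b c → ¬ External b c) →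
        InVertexlessTriangle S ⊎ InConcurrentTriple S
      -- Any nonzero abscissa would do. The concurrent alternative is taken since `triangle` asks
      -- for missing points, and `gcd (q ∸ 1) t ≡ 1` does not exclude `t ≡ 0`.
      go (inj₂ none) = inj₂ (concurrent 1# (0≢1 ∘ sym) λ ext → contradiction ext (none _ _))
      go (inj₁ (b , c , ext)) = on-secant (unique-secant ext)
        where
        on-secant : (∃ λ i → avoiding i ≡ true × Another b c i ×
            (∀ j → avoiding j ≡ true → Another b c j → j ≡ i)) →
          InVertexlessTriangle S ⊎ InConcurrentTriple S
        on-secant (i , avoiding-i , _ , unique-i) = conclude i avoiding-i all-on
          where
          distinct-on : ∀ {b' c'} → External b' c' → affine b' c' ≢ affine b c → Inc (affine b' c') (through b c i)
          distinct-on {b'} {c'} ext' R'≢R with join ext ext' R'≢R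
          ... | j , avoiding-j , another-j , inc =
            subst (λ j → Inc (affine b' c') (through b c j)) (unique-i j avoiding-j another-j) inc

          all-on : ∀ {b' c'} → External b' c' → Inc (affine b' c') (through b c i)
          all-on {b'} {c'} ext' with b' ≟ b | c' ≟ c
          ... | yes refl | yes refl = through-inc b c i
          ... | no b'≢b  | _        = distinct-on ext' (b'≢b ∘ proj₁ ∘ affine-injective)
          ... | yes _    | no c'≢c  = distinct-on ext' (c'≢c ∘ proj₂ ∘ affine-injective)

          conclude : ∀ i → avoiding i ≡ true → (∀ {b' c'} → External b' c' → Inc (affine b' c') (through b c i)) →
            InVertexlessTriangle S ⊎ InConcurrentTriple S
          -- The secant is the vertical line through the chosen external point; it passes through
          -- the vertex, and `b ≢ 0#` separates it from ℓ₂.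
          conclude nothing  _   on = inj₂ (concurrent (- b) (-b≢0 (proj₁ ext)) on)
          conclude (just m) t₁m on =
            inj₁ (triangle m (project b c m) t₁m (trans (sym (t₁-project ext m)) t₁m) on)

theorem4p6 : (p r q : ℕ) → Prime p → q ≡ p ^ r → (F : FiniteField q) →
    (t : ℕ) → t < q ∸ 1 → (S : PG2.PointSet F) →
    PG2.IsSemiarc F t S → PG2.IsVtCircType F t S →
    ((gcd q t ≡ 1 → gcd (q ∸ 1) (t ∸ 1) ≡ 1 → PG2.IsVtConf F t S) ×
    (gcd q t ≡ 1 → PG2.InVertexlessTriangle F S) ×
    (gcd (q ∸ 1) t ≡ 1 → PG2.InVertexlessTriangle F S ⊎ PG2.InConcurrentTriple F S))
theorem4p6 p r q _ _ F t t<q∸1 S (_ , semiarc) (ℓ₁ , ℓ₂ , ℓ₁≢ℓ₂ , vertex∉S , conf) =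
  (λ coprime coprime′ → IsVtConf-of-no-external
    (CharacteristicCoprime.no-external (coprime⇒⋆1≢0 coprime) coprime′)) ,
  (λ coprime → CharacteristicCoprime.in-triangle (coprime⇒⋆1≢0 coprime)) ,
  OrderCoprime.in-triangle-or-concurrent
  where
  open FieldSums F using (coprime⇒⋆1≢0)
  open VType F t t<q∸1 S semiarc ℓ₁ ℓ₂ (Coordinates.coordinatise F ℓ₁≢ℓ₂) vertex∉S conf
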